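{- Let $(W,S)$ be a Weyl group, and let $\mathbf L$ be the minuscule middle order on $W$ induced by a permutation $s_{i_1},\dots,s_{i_r}$ of $S$. Let $\omega=\omega_r\omega_{r-1}\cdots\omega_2\omega_1$ where for all $1\le k\le r$, $\omega_k$ is a reduced word for the minimal-length element of the topmost coset in $W_{\{s_{i_{k+1}},\dots,s_{i_r}\}}\backslash W_{\{s_{i_k},\dots,s_{i_r}\}}$ (i.e. for the longest among the minimal-length coset representatives). Then $\mathbf L$ is equal to the $\omega$-sorting order $\mathbf{Sort}_\omega$.
   Context: $(W,S)$ is a finite Weyl group with root system $\Phi=\Phi^+\sqcup\Phi^-$, simple roots $\alpha_s$ ($s\in S$); $\Phi^+$ is ordered by $\alpha\le\beta$ iff $\beta-\alpha$ is a nonnegative combination of positive roots. A simple root is minuscule if it appears with multiplicity $1$ in the expression of the maximal root of its irreducible component of $\Phi^+$ as a combination of simple roots. For $J\subset S$, $W_J$ is the parabolic subgroup generated by $J$, and ${}^JW$ is the set of minimal-length elements of the cosets in $W_J\backslash W$; every $w\in W$ factors uniquely as $w=w_J\cdot{}^Jw$ with $w_J\in W_J$, ${}^Jw\in{}^JW$. If $J=S\setminus\{s\}$ with $\alpha_s$ minuscule, the right weak order and the Bruhat order coincide on ${}^JW$ and give a distributive lattice. Minuscule middle orders: let $s_{i_1},\dots,s_{i_r}$ be a permutation of $S$ such that for all $1\le k\le r$, $\alpha_{s_{i_k}}$ is a minuscule root of $W_{\{s_{i_k},\dots,s_{i_r}\}}$. The minuscule middle order $(W,\le_{s_{i_1},\dots,s_{i_r}})$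 is defined recursively as the product $(W_J,\le_{s_{i_2},\dots,s_{i_r}})\times{}^JW$ with $J=S\setminus\{s_{i_1}\}$, i.e. $v\le w$ iff $v_J\le_{s_{i_2},\dots,s_{i_r}}w_J$ and ${}^Jv\le{}^Jw$ in ${}^JW$. Sorting order: for a reduced word $\omega$ of the longest element $w_0$ and $w\in W$, $\mathrm{sort}_\omega(w)$ is the set of positions of the lexicographically first (comparing position sets) subword of $\omega$ that is a reduced word for $w$; $v\le w$ in $\mathbf{Sort}_\omega$ iff $\mathrm{sort}_\omega(v)\subset\mathrm{sort}_\omega(w)$. -}

module Defs where

open import Data.Bool.Base as Bool using (Bool)
open import Data.Fin.Base using (Fin)
open import Data.Fin.Properties using (_≟_; all?)
open import Data.Fin.Subset using (Subset; _⊆_; inside; outside)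
open import Data.Integer.Base using (ℤ; 0ℤ; 1ℤ; -1ℤ; _+_; _-_; _*_; _≤_)
import Data.Integer.Properties as ℤ
open import Data.List.Base using (List; []; _∷_; [_]; _++_; length; allFin; cartesianProductWith)
open import Data.List.Membership.Propositional using (_∈_; _∉_)
open import Data.List.Relation.Unary.All using (All)
open import Data.List.Relation.Unary.Any using (any?)
open import Data.Nat.Base as ℕ using (ℕ; zero; suc)
open import Data.Product.Base using (∃-syntax; _×_)
open import Data.Sum.Base using (_⊎_)
open import Data.Unit.Base using (⊤)
open import Data.Vec.Base as Vec using (Vec; []; _∷_; lookup; map; replicate; tabulate; zipWith)
import Data.Vec.Properties as Vec
import Data.Vec.Relation.Binary.Lex.Strict as Lex
import Data.Vec.Relation.Unary.All as Vec
open import Function.Base using (flip; _∘_)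
open import Relation.Binary.Construct.Closure.Equivalence using (EqClosure)
open import Relation.Binary.PropositionalEquality using (_≡_; _≢_)
open import Relation.Nullary using (Dec; yes; no; does)
open import Relation.Unary using (Decidable)

infixl 6 _⊖_ _⊕_
infixl 7 _·_

_⊕_ _⊖_ : ∀ {n} → Vec ℤ n → Vec ℤ n → Vec ℤ n
_⊕_ = zipWith _+_
_⊖_ = zipWith _-_

_·_ : ∀ {n} → ℤ → Vec ℤ n → Vec ℤ n
c · v = map (c *_) v

⟨_,_⟩ : ∀ {n} → Vec ℤ n → Vec ℤ n → ℤ
⟨ v , f ⟩ = Vec.foldr _ _+_ 0ℤ (zipWith _*_ v f)

Nonneg : ∀ {n} → Vec ℤ n → Set
Nonneg = Vec.All (0ℤ ≤_)

Nonpos : ∀ {n} → Vec ℤ n → Set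
Nonpos = Vec.All (_≤ 0ℤ)

-- S is Fin n, and αᵢ is the i-th basis vector.
simple : ∀ {n} → Fin n → Vec ℤ n
simple i = tabulate λ j → Bool.if does (i ≟ j) then 1ℤ else 0ℤ

-- A reduced crystallographic root system of rank n with a chosen base.
-- Every root is an integral combination of the base, so vectors are given
-- by their coordinates in the base, and the root lattice ℤⁿ stands for
-- the ambient space.  A linear form is given by its values on the base:
-- the i-th entry of  coroot α  is the Cartan integer ⟨ αᵢ , α^∨ ⟩.
-- The value of  coroot  outside the roots plays no role.
record RootSystem (n : ℕ) : Set where
  field
    roots  : List (Vec ℤ n)
    coroot : Vec ℤ n → Vec ℤ n

  reflect : Vec ℤ n → Vec ℤ n → Vec ℤ n
  reflect α v = v ⊖ ⟨ v , coroot α ⟩ · α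

  field
    simple-root          : ∀ i → simple i ∈ roots
    positive-or-negative : ∀ {α} → α ∈ roots → Nonneg α ⊎ Nonpos α
    coroot-self          : ∀ {α} → α ∈ roots → ⟨ α , coroot α ⟩ ≡ 1ℤ + 1ℤ
    reflect-root         : ∀ {α β} → α ∈ roots → β ∈ roots → reflect α β ∈ roots
    reduced              : ∀ {α} c → α ∈ roots → c · α ∈ roots → c ≡ 1ℤ ⊎ c ≡ -1ℤ

-- The least k < b satisfying P, or b if there is none.
least : ∀ {P : ℕ → Set} → Decidable P → ℕ → ℕ
least P? zero = zero
least P? (suc b) with P? zero
... | yes _ = zero
... | no  _ = suc (least (P? ∘ suc) b)

-- Elements of W are represented by words in the simple reflections,
-- equality in W being _≈_; multiplication is _++_ and the identity is [].
Word : ℕ → Set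
Word n = List (Fin n)

wordsOfLength : ∀ {n} → ℕ → List (Word n)
wordsOfLength zero    = [ [] ]
wordsOfLength (suc k) = cartesianProductWith _∷_ (allFin _) (wordsOfLength k)

subword : ∀ {n} (ω : Word n) → Subset (length ω) → Word n
subword []      []            = []
subword (s ∷ ω) (inside  ∷ I) = s ∷ subword ω I
subword (s ∷ ω) (outside ∷ I) = subword ω I

-- I precedes J when I contains the first position at which they differ.
-- Among sets of the same size, such as those of the reduced subwords for
-- one element, this is the lexicographic order on increasing sequences.
_≤lex_ : ∀ {N} → Subset N → Subset N → Set
_≤lex_ = Lex.Lex-≤ _≡_ (flip Bool._<_)

module WeylGroup {n : ℕ} (R : RootSystem n) where
  open RootSystem R

  infix 4 _≈_ _≈?_ _∈W_ _≤R_

  act : Word n → Vec ℤ n → Vec ℤ n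
  act []      v = v
  act (s ∷ w) v = reflect (simple s) (act w v)

  -- W is a group of linear maps, and these are equal when they agree on the
  -- base.
  _≈_ : Word n → Word n → Set
  v ≈ w = ∀ i → act v (simple i) ≡ act w (simple i)

  _≈?_ : ∀ v w → Dec (v ≈ w)
  v ≈? w = all? λ i → Vec.≡-dec ℤ._≟_ (act v (simple i)) (act w (simple i))

  ℓ : Word n → ℕ
  ℓ w = least (λ k → any? (_≈? w) (wordsOfLength k)) (length w)

  Reduced : Word n → Set
  Reduced u = length u ≡ ℓ u

  ReducedWordFor : Word n → Word n → Set
  ReducedWordFor w u = Reduced u × u ≈ w

  Longest : Word n → Set
  Longest w = ∀ v → ℓ v ℕ.≤ ℓ w

  -- The right weak order.
  _≤R_ : Word n → Word n → Set
  v ≤R w = ∃[ u ] v ++ u ≈ w × ℓ v ℕ.+ ℓ u ≡ ℓ w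

  -- Subsets of S are given by lists of their elements.
  _∈W_ : Word n → List (Fin n) → Set
  w ∈W K = ∃[ u ] All (_∈ K) u × u ≈ w

  -- MinRep J K w : w lies in W_K and has minimal length in its coset W_J w.
  MinRep : List (Fin n) → List (Fin n) → Word n → Set
  MinRep J K w = w ∈W K × (∀ u → u ∈W J → ℓ w ℕ.≤ ℓ (u ++ w))

  TopMinRep : List (Fin n) → List (Fin n) → Word n → Set
  TopMinRep J K w = MinRep J K w × (∀ v → MinRep J K v → ℓ v ℕ.≤ ℓ w)

  -- The roots of W_K.
  RootOf : List (Fin n) → Vec ℤ n → Set
  RootOf K α = α ∈ roots × (∀ i → i ∉ K → lookup α i ≡ 0ℤ)

  PositiveOf : List (Fin n) → Vec ℤ n → Set
  PositiveOf K α = RootOf K α × Nonneg α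

  -- Nonnegative combinations of the positive roots of W_K.
  data Cone (K : List (Fin n)) : Vec ℤ n → Set where
    zero : Cone K (replicate n 0ℤ)
    add  : ∀ {α v} → PositiveOf K α → Cone K v → Cone K (α ⊕ v)

  Linked : List (Fin n) → Vec ℤ n → Vec ℤ n → Set
  Linked K α β = RootOf K α × RootOf K β × ⟨ α , coroot β ⟩ ≢ 0ℤ

  -- The irreducible components of the root system of W_K are the classes of
  -- the equivalence relation generated by non-orthogonality.
  SameComponent : List (Fin n) → Vec ℤ n → Vec ℤ n → Set
  SameComponent K = EqClosure (Linked K)

  MaximalRoot : List (Fin n) → Fin n → Vec ℤ n → Set
  MaximalRoot K s θ =
      PositiveOf K θ × SameComponent K (simple s) θ
    × (∀ β → PositiveOf K β → SameComponent K (simple s) β → Cone K (θ ⊖ β))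

  Minuscule : List (Fin n) → Fin n → Set
  Minuscule K s = ∃[ θ ] MaximalRoot K s θ × lookup θ s ≡ 1ℤ

  MinusculeSequence : List (Fin n) → Set
  MinusculeSequence []      = ⊤
  MinusculeSequence (s ∷ K) = Minuscule (s ∷ K) s × MinusculeSequence K

  -- MiddleOrder K is an order on W_K; the data in the second clause are the
  -- factorizations v = v_J · ᴶv and w = w_J · ᴶw for J = K in W_{s ∷ K}.
  MiddleOrder : List (Fin n) → Word n → Word n → Set
  MiddleOrder []      v w = v ≈ w
  MiddleOrder (s ∷ K) v w =
    ∃[ vJ ] ∃[ Jv ] ∃[ wJ ] ∃[ Jw ]
      (vJ ∈W K × MinRep K (s ∷ K) Jv × vJ ++ Jv ≈ v)
    × (wJ ∈W K × MinRep K (s ∷ K) Jw × wJ ++ Jw ≈ w)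
    × MiddleOrder K vJ wJ
    × Jv ≤R Jw

  -- TopWord (s₁ ∷ … ∷ sᵣ ∷ []) ω : ω = ωᵣ ⋯ ω₁ with ωₖ a reduced word for the
  -- longest minimal-length representative of the cosets
  -- W_{sₖ₊₁,…,sᵣ} \ W_{sₖ,…,sᵣ}.
  data TopWord : List (Fin n) → Word n → Set where
    []   : TopWord [] []
    snoc : ∀ {s K ω ωₖ} → TopWord K ω →
           Reduced ωₖ → TopMinRep K (s ∷ K) ωₖ → TopWord (s ∷ K) (ω ++ ωₖ)

  IsSort : (ω w : Word n) → Subset (length ω) → Set
  IsSort ω w I =
      ReducedWordFor w (subword ω I)
    × (∀ J → ReducedWordFor w (subword ω J) → I ≤lex J)

  SortingOrder : (ω : Word n) → Word n → Word n → Set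
  SortingOrder ω v w = ∃[ I ] ∃[ J ] IsSort ω v I × IsSort ω w J × I ⊆ J

module Submission where

-- Let J = S ∖ {s}.  A word is played as a game on the functional
-- "coordinate at αₛ": after w the vertex j carries the αₛ-coordinate of w αⱼ,
-- and firing i means appending sᵢ when i carries 1.  The reduced words of the
-- elements of ᴶW are exactly the legal plays, and since αₛ is minuscule no
-- value ever exceeds 1.  Hence, if i carries 1, the letters played before the
-- next i are orthogonal to i, so that i can be moved to the front.  It follows
-- that an element of ᴶW is determined by how often each letter occurs in it,
-- that the right weak order compares these numbers, and that the leftmost
-- subword of a maximal play takes the first so many occurrences of each letter.
-- Inductively, sort_ω of w = w_J · ᴶw is the concatenation of the sets for w_J
-- in ωᵣ⋯ω₂ and for ᴶw in ω₁, whence the theorem.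

open import Defs
open import Data.Fin.Base using (Fin)
open import Data.List.Base using (List; allFin)
open import Data.List.Relation.Binary.Permutation.Propositional using (_↭_)
open import Data.Nat.Base using (ℕ)
open import Data.Product.Base using (_×_)
open import Function.Bundles using (_⇔_)

open import Data.Bool.Base as Bool using (Bool; if_then_else_)
import Data.Bool.Properties as Bool
open import Data.Fin.Base using (zero; suc)
open import Data.Fin.Properties using (_≟_)
open import Data.Fin.Subset using (Subset; _⊆_; inside; outside)
open import Data.Fin.Subset.Properties using (s⊆s; out⊆; drop-∷-⊆)
open import Data.Integer.Base as ℤ using (ℤ; 0ℤ; 1ℤ; -1ℤ; _+_; _-_; -_; _*_; _≤_; +≤+)
import Data.Integer.Properties as ℤ
open import Data.Integer.Tactic.RingSolver using (solve-∀)
open import Data.List.Base using ([]; _∷_; [_]; _++_; length; reverse)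
import Data.List.Properties as List
open import Data.List.Membership.Propositional using (find; lose) renaming (_∈_ to _∈ˡ_; _∉_ to _∉ˡ_)
open import Data.List.Membership.Propositional.Properties
  using (∈-cartesianProductWith⁺; ∈-cartesianProductWith⁻; ∈-allFin)
open import Data.List.Relation.Binary.Permutation.Propositional as ↭
  using (↭-refl; ↭-sym; ↭-trans; ↭⇒↭ₛ; prep; swap)
open import Data.List.Relation.Binary.Permutation.Propositional.Properties using (↭-length; ∈-resp-↭)
import Data.List.Relation.Binary.Permutation.Setoid.Properties as Permutation
open import Data.List.Relation.Unary.All as All using (All; []; _∷_)
import Data.List.Relation.Unary.All.Properties as All
open import Data.List.Relation.Unary.AllPairs using ([]; _∷_)
open import Data.List.Relation.Unary.Any using (here; there; any?)
import Data.List.Relation.Unary.Any.Properties as Any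
open import Data.List.Relation.Unary.Unique.Propositional using (Unique)
open import Data.List.Relation.Unary.Unique.Propositional.Properties using (allFin⁺)
open import Data.List.Reverse using (Reverse; reverseView; []; _∶_∶ʳ_)
open import Data.Nat.Base as ℕ using (zero; suc; z≤n; s≤s; _∸_)
import Data.Nat.Properties as ℕ
open import Algebra.Properties.CommutativeSemigroup ℕ.+-commutativeSemigroup using (x∙yz≈y∙xz)
open import Data.Product.Base using (∃-syntax; _,_; proj₁; proj₂)
open import Data.Sum.Base using (_⊎_; inj₁; inj₂; [_,_]′)
open import Data.Unit.Base using (⊤; tt)
open import Data.Vec.Base using (Vec; []; _∷_; here; there; lookup; tabulate)
import Data.Vec.Properties as Vec
open import Data.Vec.Relation.Binary.Lex.Core as Lex using (base; this; next)
open import Data.Vec.Relation.Binary.Pointwise.Inductive using (Pointwise-≡⇒≡)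
open import Data.Vec.Relation.Unary.All.Properties using (lookup⁺; lookup⁻)
open import Data.Empty using (⊥)
open import Function.Base using (_∘_)
open import Function.Bundles using (mk⇔; Equivalence)
open import Level using (0ℓ)
open import Relation.Binary.Bundles using (Setoid)
open import Relation.Binary.Construct.Closure.ReflexiveTransitive using (ε; _◅_; _◅◅_)
open import Relation.Binary.Construct.Closure.Symmetric using (fwd; bwd)
open import Relation.Binary.PropositionalEquality hiding ([_])
import Relation.Binary.Reasoning.Setoid as SetoidReasoning
open import Relation.Nullary using (Dec; ¬_; yes; no; does; contradiction)
open import Relation.Nullary.Decidable using (dec-true; dec-false; decidable-stable)
open import Relation.Unary using (Decidable)

-- Linear algebra over ℤ

-- A root system is given here without an invariant bilinear form, so the theory of reduced words
-- has to be drawn from the dichotomy that the coordinates of a root have one sign: a single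
-- coordinate equal to 1 makes a root positive, and a positive root that `reflect (simple k)` makes
-- negative is αₖ. The exchange property, commutation of orthogonal letters and additivity of
-- lengths over cosets all come from this.
--
-- The delicate point of the induction is the last concatenation. The word ω₁ also contains letters
-- of J, so a subword of ω for w_J · ᴶw may spell part of w_J inside ω₁, and it need not meet ωᵣ⋯ω₂
-- in a word for w_J. What survives is that its part in ωᵣ⋯ω₂ spells a left factor of w_J with
-- lengths adding, which follows from uniqueness of the factorization over J.

vec-ext : ∀ {n} {u v : Vec ℤ n} → (∀ k → lookup u k ≡ lookup v k) → u ≡ v
vec-ext {u = u} {v} eq =
  trans (sym (Vec.tabulate∘lookup u)) (trans (Vec.tabulate-cong eq) (Vec.tabulate∘lookup v))

module _ {n : ℕ} where

  lookup-⊕ : ∀ (u v : Vec ℤ n) k → lookup (u ⊕ v) k ≡ lookup u k + lookup v k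
  lookup-⊕ u v k = Vec.lookup-zipWith _+_ k u v

  lookup-⊖ : ∀ (u v : Vec ℤ n) k → lookup (u ⊖ v) k ≡ lookup u k - lookup v k
  lookup-⊖ u v k = Vec.lookup-zipWith _-_ k u v

  lookup-· : ∀ c (v : Vec ℤ n) k → lookup (c · v) k ≡ c * lookup v k
  lookup-· c v k = Vec.lookup-map k (c *_) v

  lookup-simple-refl : ∀ (i : Fin n) → lookup (simple i) i ≡ 1ℤ
  lookup-simple-refl i = trans (Vec.lookup∘tabulate _ i)
    (cong (if_then 1ℤ else 0ℤ) (dec-true (i ≟ i) refl))

  lookup-simple-≢ : ∀ {i j : Fin n} → i ≢ j → lookup (simple i) j ≡ 0ℤ
  lookup-simple-≢ {i} {j} i≢j = trans (Vec.lookup∘tabulate _ j)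
    (cong (if_then 1ℤ else 0ℤ) (dec-false (i ≟ j) i≢j))

  lookup-simple-nonneg : ∀ (i j : Fin n) → 0ℤ ≤ lookup (simple i) j
  lookup-simple-nonneg i j with i ≟ j
  ... | yes refl = subst (0ℤ ≤_) (sym (lookup-simple-refl i)) (+≤+ z≤n)
  ... | no  i≢j  = ℤ.≤-reflexive (sym (lookup-simple-≢ i≢j))

⟨⊕,⟩ : ∀ {n} (u v f : Vec ℤ n) → ⟨ u ⊕ v , f ⟩ ≡ ⟨ u , f ⟩ + ⟨ v , f ⟩
⟨⊕,⟩ []      []      []      = refl
⟨⊕,⟩ (x ∷ u) (y ∷ v) (z ∷ f) = trans (cong (((x + y) * z) +_) (⟨⊕,⟩ u v f)) (lemma x y z _ _)
  where
  lemma : ∀ x y z a b → (x + y) * z + (a + b) ≡ (x * z + a) + (y * z + b)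
  lemma = solve-∀

⟨·,⟩ : ∀ {n} c (v f : Vec ℤ n) → ⟨ c · v , f ⟩ ≡ c * ⟨ v , f ⟩
⟨·,⟩ c []      []      = sym (ℤ.*-zeroʳ c)
⟨·,⟩ c (y ∷ v) (z ∷ f) = trans (cong ((c * y * z) +_) (⟨·,⟩ c v f)) (lemma c y z _)
  where
  lemma : ∀ c y z a → c * y * z + c * a ≡ c * (y * z + a)
  lemma = solve-∀

⟨,⟩-nonneg : ∀ {n} (v f : Vec ℤ n) → (∀ i → 0ℤ ≤ lookup v i * lookup f i) → 0ℤ ≤ ⟨ v , f ⟩
⟨,⟩-nonneg []      []      _   = ℤ.≤-refl
⟨,⟩-nonneg (x ∷ v) (y ∷ f) pos = ℤ.+-mono-≤ (pos zero) (⟨,⟩-nonneg v f (pos ∘ suc))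

-- Coordinates, pairings with a coroot, and their composites with elements of W are all treated as
-- such forms, so that one formula for reflections serves them all.
record Linear {n} (L : Vec ℤ n → ℤ) : Set where
  field
    ⊕-homo : ∀ u v → L (u ⊕ v) ≡ L u + L v
    ·-homo : ∀ c v → L (c · v) ≡ c * L v

  ⊖-homo : ∀ u v → L (u ⊖ v) ≡ L u - L v
  ⊖-homo u v = trans (cong L (vec-ext λ k → trans (lookup-⊖ u v k) (sym (begin
      lookup (u ⊕ -1ℤ · v) k           ≡⟨ lookup-⊕ u _ k ⟩
      lookup u k + lookup (-1ℤ · v) k  ≡⟨ cong (lookup u k +_) (lookup-· -1ℤ v k) ⟩
      lookup u k + -1ℤ * lookup v k    ≡⟨ cong (lookup u k +_) (ℤ.-1*i≡-i _) ⟩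
      lookup u k - lookup v k          ∎))))
    (trans (⊕-homo u _) (cong (λ x → L u + x) (trans (·-homo -1ℤ v) (ℤ.-1*i≡-i _))))
    where open ≡-Reasoning

open Linear

lookup-linear : ∀ {n} (k : Fin n) → Linear (λ v → lookup v k)
lookup-linear k = record { ⊕-homo = λ u v → lookup-⊕ u v k ; ·-homo = λ c v → lookup-· c v k }

⟨,⟩-linear : ∀ {n} (f : Vec ℤ n) → Linear ⟨_, f ⟩
⟨,⟩-linear f = record { ⊕-homo = λ u v → ⟨⊕,⟩ u v f ; ·-homo = λ c v → ⟨·,⟩ c v f }

linear-zero : ∀ {n} {L : Vec ℤ n → ℤ} → Linear L → ∀ {z} → (∀ k → lookup z k ≡ 0ℤ) → L z ≡ 0ℤ
linear-zero {L = L} lin {z} z≡0 = trans (cong L (vec-ext λ k → begin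
    lookup z k        ≡⟨ z≡0 k ⟩
    0ℤ                ≡⟨ ℤ.*-zeroˡ (lookup z k) ⟨
    0ℤ * lookup z k   ≡⟨ lookup-· 0ℤ z k ⟨
    lookup (0ℤ · z) k ∎)) (trans (·-homo lin 0ℤ z) (ℤ.*-zeroˡ (L z)))
  where open ≡-Reasoning

linear-repr : ∀ {n} {L : Vec ℤ n → ℤ} → Linear L → ∀ v → L v ≡ ⟨ v , tabulate (L ∘ simple) ⟩
linear-repr lin [] = linear-zero lin λ ()
linear-repr {L = L} lin (x ∷ v) = begin
  L (x ∷ v)                          ≡⟨ cong L (vec-ext split) ⟩
  L (x · simple zero ⊕ (0ℤ ∷ v))     ≡⟨ ⊕-homo lin _ _ ⟩
  L (x · simple zero) + L (0ℤ ∷ v)   ≡⟨ cong₂ _+_ (·-homo lin x (simple zero)) (linear-repr tail-linear v) ⟩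
  x * L (simple zero) + ⟨ v , tabulate (L ∘ simple ∘ suc) ⟩ ∎
  where
  open ≡-Reasoning
  tail-linear : Linear (L ∘ (0ℤ ∷_))
  tail-linear = record
    { ⊕-homo = λ u v → ⊕-homo lin (0ℤ ∷ u) (0ℤ ∷ v)
    ; ·-homo = λ c v → trans (cong (λ a → L (a ∷ c · v)) (sym (ℤ.*-zeroʳ c))) (·-homo lin c (0ℤ ∷ v))
    }
  split : ∀ k → lookup (x ∷ v) k ≡ lookup (x · simple zero ⊕ (0ℤ ∷ v)) k
  split zero    = sym (trans (ℤ.+-identityʳ _) (ℤ.*-identityʳ x))
  split (suc k) = sym (begin
    lookup (x · tabulate (λ _ → 0ℤ) ⊕ v) k              ≡⟨ lookup-⊕ (x · tabulate (λ _ → 0ℤ)) v k ⟩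
    lookup (x · tabulate (λ _ → 0ℤ)) k + lookup v k     ≡⟨ cong (_+ lookup v k) (lookup-· x (tabulate (λ _ → 0ℤ)) k) ⟩
    x * lookup (tabulate (λ _ → 0ℤ)) k + lookup v k     ≡⟨ cong (λ a → x * a + lookup v k) (Vec.lookup∘tabulate _ k) ⟩
    x * 0ℤ + lookup v k                                 ≡⟨ cong (_+ lookup v k) (ℤ.*-zeroʳ x) ⟩
    0ℤ + lookup v k                                     ≡⟨ ℤ.+-identityˡ _ ⟩
    lookup v k                                          ∎)

linear-ext : ∀ {n} {L M : Vec ℤ n → ℤ} → Linear L → Linear M →
             (∀ i → L (simple i) ≡ M (simple i)) → ∀ v → L v ≡ M v
linear-ext lin lin′ eq v =
  trans (linear-repr lin v) (trans (cong ⟨ v ,_⟩ (Vec.tabulate-cong eq)) (sym (linear-repr lin′ v)))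

0≤* : ∀ {x y} → 0ℤ ≤ x → 0ℤ ≤ y → 0ℤ ≤ x * y
0≤* {ℤ.+ a} {ℤ.+ b} _ _ = subst (0ℤ ≤_) (ℤ.pos-* a b) (+≤+ z≤n)

-- The condition is confined to the support of v so that a form controlled only on the simple roots
-- of a parabolic subgroup can be applied to the roots of that subgroup.
linear-nonneg : ∀ {n} {L : Vec ℤ n → ℤ} → Linear L → ∀ {v} → Nonneg v →
                (∀ i → lookup v i ≢ 0ℤ → 0ℤ ≤ L (simple i)) → 0ℤ ≤ L v
linear-nonneg {L = L} lin {v} v≥0 pos = subst (0ℤ ≤_) (sym (linear-repr lin v))
  (⟨,⟩-nonneg v _ λ i → subst (λ y → 0ℤ ≤ lookup v i * y) (sym (Vec.lookup∘tabulate _ i)) (entry i))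
  where
  entry : ∀ i → 0ℤ ≤ lookup v i * L (simple i)
  entry i with lookup v i ℤ.≟ 0ℤ
  ... | yes v≡0 = ℤ.≤-reflexive (sym (trans (cong (_* L (simple i)) v≡0) (ℤ.*-zeroˡ (L (simple i)))))
  ... | no  v≢0 = 0≤* (lookup⁺ v≥0 i) (pos i v≢0)

-- The Weyl group acting on the root lattice, and signs of Cartan integers

module Basics {n : ℕ} (R : RootSystem n) where
  open RootSystem R
  open WeylGroup R

  cartan : Fin n → Fin n → ℤ
  cartan j i = ⟨ simple j , coroot (simple i) ⟩

  lookup-reflect : ∀ α v k → lookup (reflect α v) k ≡ lookup v k - ⟨ v , coroot α ⟩ * lookup α k
  lookup-reflect α v k = trans (lookup-⊖ v (⟨ v , coroot α ⟩ · α) k) (cong (λ x → lookup v k - x) (lookup-· ⟨ v , coroot α ⟩ α k))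

  linear-reflect : ∀ {L} → Linear L → ∀ α v → L (reflect α v) ≡ L v - ⟨ v , coroot α ⟩ * L α
  linear-reflect {L} lin α v = trans (⊖-homo lin v (⟨ v , coroot α ⟩ · α)) (cong (λ x → L v - x) (·-homo lin ⟨ v , coroot α ⟩ α))

  reflect-⊕ : ∀ α u v → reflect α (u ⊕ v) ≡ reflect α u ⊕ reflect α v
  reflect-⊕ α u v = vec-ext λ k → begin
    lookup (reflect α (u ⊕ v)) k
      ≡⟨ lookup-reflect α (u ⊕ v) k ⟩
    lookup (u ⊕ v) k - ⟨ u ⊕ v , coroot α ⟩ * lookup α k
      ≡⟨ cong₂ (λ x y → x - y * lookup α k) (lookup-⊕ u v k) (⟨⊕,⟩ u v (coroot α)) ⟩
    lookup u k + lookup v k - (⟨ u , coroot α ⟩ + ⟨ v , coroot α ⟩) * lookup α k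
      ≡⟨ lemma (lookup u k) (lookup v k) ⟨ u , coroot α ⟩ ⟨ v , coroot α ⟩ (lookup α k) ⟩
    (lookup u k - ⟨ u , coroot α ⟩ * lookup α k) + (lookup v k - ⟨ v , coroot α ⟩ * lookup α k)
      ≡⟨ cong₂ _+_ (lookup-reflect α u k) (lookup-reflect α v k) ⟨
    lookup (reflect α u) k + lookup (reflect α v) k
      ≡⟨ lookup-⊕ (reflect α u) (reflect α v) k ⟨
    lookup (reflect α u ⊕ reflect α v) k ∎
    where
    open ≡-Reasoning
    lemma : ∀ x y a b z → x + y - (a + b) * z ≡ (x - a * z) + (y - b * z)
    lemma = solve-∀

  reflect-· : ∀ α c v → reflect α (c · v) ≡ c · reflect α v
  reflect-· α c v = vec-ext λ k → begin
    lookup (reflect α (c · v)) k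
      ≡⟨ lookup-reflect α (c · v) k ⟩
    lookup (c · v) k - ⟨ c · v , coroot α ⟩ * lookup α k
      ≡⟨ cong₂ (λ x y → x - y * lookup α k) (lookup-· c v k) (⟨·,⟩ c v (coroot α)) ⟩
    c * lookup v k - c * ⟨ v , coroot α ⟩ * lookup α k
      ≡⟨ lemma c (lookup v k) ⟨ v , coroot α ⟩ (lookup α k) ⟩
    c * (lookup v k - ⟨ v , coroot α ⟩ * lookup α k)
      ≡⟨ cong (c *_) (lookup-reflect α v k) ⟨
    c * lookup (reflect α v) k
      ≡⟨ lookup-· c (reflect α v) k ⟨
    lookup (c · reflect α v) k ∎
    where
    open ≡-Reasoning
    lemma : ∀ c x a z → c * x - c * a * z ≡ c * (x - a * z)
    lemma = solve-∀

  act-⊕ : ∀ w u v → act w (u ⊕ v) ≡ act w u ⊕ act w v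
  act-⊕ []      u v = refl
  act-⊕ (s ∷ w) u v = trans (cong (reflect (simple s)) (act-⊕ w u v)) (reflect-⊕ (simple s) (act w u) (act w v))

  act-· : ∀ w c v → act w (c · v) ≡ c · act w v
  act-· []      c v = refl
  act-· (s ∷ w) c v = trans (cong (reflect (simple s)) (act-· w c v)) (reflect-· (simple s) c (act w v))

  act-linear : ∀ w {L} → Linear L → Linear (L ∘ act w)
  act-linear w {L} lin = record
    { ⊕-homo = λ u v → trans (cong L (act-⊕ w u v)) (⊕-homo lin (act w u) (act w v))
    ; ·-homo = λ c v → trans (cong L (act-· w c v)) (·-homo lin c (act w v))
    }

  act-++ : ∀ u v x → act (u ++ v) x ≡ act u (act v x)
  act-++ []      v x = refl
  act-++ (s ∷ u) v x = cong (reflect (simple s)) (act-++ u v x)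

  infix 4 _≋_

  -- _≈_ unfolds to a function type, from which Agda cannot infer the words.
  record _≋_ (v w : Word n) : Set where
    constructor ⌜_⌝
    field ⌞_⌟ : v ≈ w

  open _≋_ public

  ≋⇒act≡ : ∀ {v w} → v ≋ w → ∀ x → act v x ≡ act w x
  ≋⇒act≡ {v} {w} ⌜ eq ⌝ x = vec-ext λ k →
    linear-ext (act-linear v (lookup-linear k)) (act-linear w (lookup-linear k)) (λ i → cong (λ y → lookup y k) (eq i)) x

  ≋-refl : ∀ {w} → w ≋ w
  ≋-refl = ⌜ (λ i → refl) ⌝

  ≋-reflexive : ∀ {v w} → v ≡ w → v ≋ w
  ≋-reflexive refl = ≋-refl

  ≋-sym : ∀ {v w} → v ≋ w → w ≋ v
  ≋-sym ⌜ eq ⌝ = ⌜ (λ i → sym (eq i)) ⌝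

  ≋-trans : ∀ {u v w} → u ≋ v → v ≋ w → u ≋ w
  ≋-trans ⌜ eq ⌝ ⌜ eq′ ⌝ = ⌜ (λ i → trans (eq i) (eq′ i)) ⌝

  ≋-setoid : Setoid 0ℓ 0ℓ
  ≋-setoid = record
    { Carrier = Word n
    ; _≈_ = _≋_
    ; isEquivalence = record { refl = ≋-refl ; sym = ≋-sym ; trans = ≋-trans }
    }

  module ≋-Reasoning = SetoidReasoning ≋-setoid

  ++-cong : ∀ {u u′ v v′} → u ≋ u′ → v ≋ v′ → u ++ v ≋ u′ ++ v′
  ++-cong {u} {u′} {v} {v′} eq ⌜ eq′ ⌝ = ⌜ (λ i → begin
    act (u ++ v) (simple i)      ≡⟨ act-++ u v _ ⟩
    act u (act v (simple i))     ≡⟨ cong (act u) (eq′ i) ⟩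
    act u (act v′ (simple i))    ≡⟨ ≋⇒act≡ eq _ ⟩
    act u′ (act v′ (simple i))   ≡⟨ act-++ u′ v′ _ ⟨
    act (u′ ++ v′) (simple i)    ∎) ⌝
    where open ≡-Reasoning

  ++-congˡ : ∀ u {v w} → v ≋ w → u ++ v ≋ u ++ w
  ++-congˡ u = ++-cong (≋-refl {u})

  ++-congʳ : ∀ {u v} w → u ≋ v → u ++ w ≋ v ++ w
  ++-congʳ w eq = ++-cong eq ≋-refl

  reflect-involutive : ∀ {α} → α ∈ˡ roots → ∀ v → reflect α (reflect α v) ≡ v
  reflect-involutive {α} α∈ v = vec-ext λ k → begin
    lookup (reflect α (reflect α v)) k
      ≡⟨ lookup-reflect α (reflect α v) k ⟩
    lookup (reflect α v) k - ⟨ reflect α v , coroot α ⟩ * lookup α k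
      ≡⟨ cong₂ (λ x y → x - y * lookup α k) (lookup-reflect α v k)
           (trans (linear-reflect (⟨,⟩-linear (coroot α)) α v) (cong (λ y → c - c * y) (coroot-self α∈))) ⟩
    lookup v k - c * lookup α k - (c - c * (1ℤ + 1ℤ)) * lookup α k
      ≡⟨ lemma (lookup v k) c (lookup α k) ⟩
    lookup v k ∎
    where
    open ≡-Reasoning
    c = ⟨ v , coroot α ⟩
    lemma : ∀ x c a → x - c * a - (c - c * (1ℤ + 1ℤ)) * a ≡ x
    lemma = solve-∀

  act-reverse : ∀ w x → act (reverse w) (act w x) ≡ x
  act-reverse []      x = refl
  act-reverse (s ∷ w) x = begin
    act (reverse (s ∷ w)) (act (s ∷ w) x)          ≡⟨ cong (λ u → act u (act (s ∷ w) x)) (List.unfold-reverse s w) ⟩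
    act (reverse w ++ [ s ]) (act (s ∷ w) x)       ≡⟨ act-++ (reverse w) [ s ] _ ⟩
    act (reverse w) (reflect (simple s) (act (s ∷ w) x)) ≡⟨ cong (act (reverse w)) (reflect-involutive (simple-root s) _) ⟩
    act (reverse w) (act w x)                      ≡⟨ act-reverse w x ⟩
    x                                              ∎
    where open ≡-Reasoning

  act-reverse′ : ∀ w x → act w (act (reverse w) x) ≡ x
  act-reverse′ w x = subst (λ u → act u (act (reverse w) x) ≡ x) (List.reverse-involutive w) (act-reverse (reverse w) x)

  inverseˡ : ∀ w → reverse w ++ w ≋ []
  inverseˡ w = ⌜ (λ i → trans (act-++ (reverse w) w _) (act-reverse w _)) ⌝

  inverseʳ : ∀ w → w ++ reverse w ≋ []
  inverseʳ w = ⌜ (λ i → trans (act-++ w (reverse w) _) (act-reverse′ w _)) ⌝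

  ++-cancelˡ : ∀ u {v w} → u ++ v ≋ u ++ w → v ≋ w
  ++-cancelˡ u {v} {w} eq = begin
    v                        ≈⟨ ++-congʳ v (inverseˡ u) ⟨
    (reverse u ++ u) ++ v    ≡⟨ List.++-assoc (reverse u) u v ⟩
    reverse u ++ (u ++ v)    ≈⟨ ++-congˡ (reverse u) eq ⟩
    reverse u ++ (u ++ w)    ≡⟨ List.++-assoc (reverse u) u w ⟨
    (reverse u ++ u) ++ w    ≈⟨ ++-congʳ w (inverseˡ u) ⟩
    w                        ∎
    where open ≋-Reasoning

  reverse-cong : ∀ {v w} → v ≋ w → reverse v ≋ reverse w
  reverse-cong {v} {w} eq = ++-cancelˡ v (begin
    v ++ reverse v   ≈⟨ inverseʳ v ⟩
    []               ≈⟨ inverseʳ w ⟨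
    w ++ reverse w   ≈⟨ ++-congʳ (reverse w) eq ⟨
    v ++ reverse w   ∎)
    where open ≋-Reasoning

  cancel-double : ∀ i w → i ∷ i ∷ w ≋ w
  cancel-double i w = ⌜ (λ j → reflect-involutive (simple-root i) _) ⌝

  act-root : ∀ w {α} → α ∈ˡ roots → act w α ∈ˡ roots
  act-root []      α∈ = α∈
  act-root (s ∷ w) α∈ = reflect-root (simple-root s) (act-root w α∈)

  act-simple-root : ∀ w i → act w (simple i) ∈ˡ roots
  act-simple-root w i = act-root w (simple-root i)

  -- Such a root would be 0, whereas it pairs to 2 with its coroot.
  nonneg-nonpos-root : ∀ {α} → α ∈ˡ roots → Nonneg α → Nonpos α → ⊥
  nonneg-nonpos-root {α} α∈ α≥0 α≤0 =
    contradiction (trans (sym (coroot-self α∈)) (linear-zero (⟨,⟩-linear (coroot α)) {α} λ k →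
      ℤ.≤-antisym (lookup⁺ α≤0 k) (lookup⁺ α≥0 k))) λ ()

  -- All coordinates of a root have the same sign, so one of them settles positivity.
  positive-coordinate : ∀ {α} k → α ∈ˡ roots → lookup α k ≡ 1ℤ → Nonneg α
  positive-coordinate k α∈ eq with positive-or-negative α∈
  ... | inj₁ α≥0 = α≥0
  ... | inj₂ α≤0 with subst (_≤ 0ℤ) eq (lookup⁺ α≤0 k)
  ...   | ℤ.+≤+ ()

  lookup-reflect-≢ : ∀ {i k} v → i ≢ k → lookup (reflect (simple i) v) k ≡ lookup v k
  lookup-reflect-≢ {i} {k} v i≢k = begin
    lookup (reflect (simple i) v) k                                    ≡⟨ lookup-reflect _ v k ⟩
    lookup v k - ⟨ v , coroot (simple i) ⟩ * lookup (simple i) k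
      ≡⟨ cong (λ x → lookup v k - ⟨ v , coroot (simple i) ⟩ * x) (lookup-simple-≢ i≢k) ⟩
    lookup v k - ⟨ v , coroot (simple i) ⟩ * 0ℤ                        ≡⟨ lemma (lookup v k) ⟨ v , coroot (simple i) ⟩ ⟩
    lookup v k ∎
    where
    open ≡-Reasoning
    lemma : ∀ x c → x - c * 0ℤ ≡ x
    lemma = solve-∀

  lookup-reflect-refl : ∀ i v → lookup (reflect (simple i) v) i ≡ lookup v i - ⟨ v , coroot (simple i) ⟩
  lookup-reflect-refl i v = trans (lookup-reflect _ v i)
    (cong (λ x → lookup v i - x) (trans (cong (⟨ v , coroot (simple i) ⟩ *_) (lookup-simple-refl i)) (ℤ.*-identityʳ _)))

  cartan-self : ∀ i → cartan i i ≡ 1ℤ + 1ℤ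
  cartan-self i = coroot-self (simple-root i)

  -- The root sᵢ αⱼ keeps the coordinate 1 at j, hence is positive, and its coordinate at i is
  -- `- cartan j i`.
  cartan-nonpos : ∀ {i j} → i ≢ j → cartan j i ≤ 0ℤ
  cartan-nonpos {i} {j} i≢j = ℤ.neg-cancel-≤ (subst (0ℤ ≤_) value (lookup⁺ γ≥0 i))
    where
    γ = act [ i ] (simple j)
    γ≥0 : Nonneg γ
    γ≥0 = positive-coordinate j (act-simple-root [ i ] j)
      (trans (lookup-reflect-≢ (simple j) i≢j) (lookup-simple-refl j))
    value : lookup γ i ≡ - cartan j i
    value = trans (lookup-reflect-refl i (simple j)) (trans (cong (_- cartan j i) (lookup-simple-≢ (i≢j ∘ sym))) (ℤ.+-identityˡ _))

  -- Otherwise sᵢ sⱼ αᵢ = -αᵢ - ⟨ αᵢ , αⱼ^∨ ⟩ αⱼ would have coordinates of both signs.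
  cartan-zero-sym : ∀ {i j} → i ≢ j → cartan j i ≡ 0ℤ → cartan i j ≡ 0ℤ
  cartan-zero-sym {i} {j} i≢j a≡0 = ℤ.≤-antisym (cartan-nonpos (i≢j ∘ sym)) (negative (positive-or-negative γ∈))
    where
    open ≡-Reasoning
    γ = act (i ∷ j ∷ []) (simple i)
    γ∈ = act-simple-root (i ∷ j ∷ []) i
    sⱼαᵢ = act [ j ] (simple i)
    f = coroot (simple i)
    pairing : ⟨ sⱼαᵢ , f ⟩ ≡ 1ℤ + 1ℤ
    pairing = begin
      ⟨ sⱼαᵢ , f ⟩                                ≡⟨ linear-reflect (⟨,⟩-linear f) (simple j) (simple i) ⟩
      cartan i i - cartan i j * cartan j i        ≡⟨ cong₂ (λ x y → x - cartan i j * y) (cartan-self i) a≡0 ⟩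
      1ℤ + 1ℤ - cartan i j * 0ℤ                   ≡⟨ lemma (cartan i j) ⟩
      1ℤ + 1ℤ                                     ∎
      where
      lemma : ∀ x → 1ℤ + 1ℤ - x * 0ℤ ≡ 1ℤ + 1ℤ
      lemma = solve-∀
    γᵢ : lookup γ i ≡ -1ℤ
    γᵢ = begin
      lookup γ i                          ≡⟨ lookup-reflect-refl i sⱼαᵢ ⟩
      lookup sⱼαᵢ i - ⟨ sⱼαᵢ , f ⟩        ≡⟨ cong₂ _-_ (trans (lookup-reflect-≢ (simple i) (i≢j ∘ sym)) (lookup-simple-refl i)) pairing ⟩
      1ℤ - (1ℤ + 1ℤ)                      ∎
    γⱼ : lookup γ j ≡ - cartan i j
    γⱼ = begin
      lookup γ j                          ≡⟨ lookup-reflect-≢ sⱼαᵢ i≢j ⟩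
      lookup sⱼαᵢ j                       ≡⟨ lookup-reflect-refl j (simple i) ⟩
      lookup (simple i) j - cartan i j    ≡⟨ cong (_- cartan i j) (lookup-simple-≢ i≢j) ⟩
      0ℤ - cartan i j                     ≡⟨ ℤ.+-identityˡ _ ⟩
      - cartan i j                        ∎
    negative : Nonneg γ ⊎ Nonpos γ → 0ℤ ≤ cartan i j
    negative (inj₁ γ≥0) with subst (0ℤ ≤_) γᵢ (lookup⁺ γ≥0 i)
    ... | ()
    negative (inj₂ γ≤0) = ℤ.neg-cancel-≤ (subst (_≤ 0ℤ) γⱼ (lookup⁺ γ≤0 j))

  -- Each reflection leaves the pairing used by the other unchanged; the second half of this needs
  -- the reversed Cartan integer, supplied by `cartan-zero-sym`.
  commute : ∀ {i j} → i ≢ j → cartan j i ≡ 0ℤ → ∀ w → i ∷ j ∷ w ≋ j ∷ i ∷ w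
  commute {i} {j} i≢j a≡0 w = ⌜ (λ m → commute-on (act w (simple m))) ⌝
    where
    open ≡-Reasoning
    αᵢ = simple i
    αⱼ = simple j
    pairing : ∀ {i j} x → cartan j i ≡ 0ℤ → ⟨ reflect (simple j) x , coroot (simple i) ⟩ ≡ ⟨ x , coroot (simple i) ⟩
    pairing {i} {j} x eq = trans (linear-reflect (⟨,⟩-linear (coroot (simple i))) (simple j) x)
      (trans (cong (λ y → ⟨ x , coroot (simple i) ⟩ - ⟨ x , coroot (simple j) ⟩ * y) eq)
        (zero-lemma ⟨ x , coroot (simple i) ⟩ ⟨ x , coroot (simple j) ⟩))
      where
      zero-lemma : ∀ p q → p - q * 0ℤ ≡ p
      zero-lemma = solve-∀
    minus-swap : ∀ p q r → p - q - r ≡ p - r - q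
    minus-swap = solve-∀
    commute-on : ∀ x → reflect αᵢ (reflect αⱼ x) ≡ reflect αⱼ (reflect αᵢ x)
    commute-on x = vec-ext λ k → begin
      lookup (reflect αᵢ (reflect αⱼ x)) k
        ≡⟨ lookup-reflect αᵢ (reflect αⱼ x) k ⟩
      lookup (reflect αⱼ x) k - ⟨ reflect αⱼ x , coroot αᵢ ⟩ * lookup αᵢ k
        ≡⟨ cong₂ (λ y z → y - z * lookup αᵢ k) (lookup-reflect αⱼ x k) (pairing {i} {j} x a≡0) ⟩
      lookup x k - ⟨ x , coroot αⱼ ⟩ * lookup αⱼ k - ⟨ x , coroot αᵢ ⟩ * lookup αᵢ k
        ≡⟨ minus-swap (lookup x k) (⟨ x , coroot αⱼ ⟩ * lookup αⱼ k) (⟨ x , coroot αᵢ ⟩ * lookup αᵢ k) ⟩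
      lookup x k - ⟨ x , coroot αᵢ ⟩ * lookup αᵢ k - ⟨ x , coroot αⱼ ⟩ * lookup αⱼ k
        ≡⟨ cong₂ (λ y z → y - z * lookup αⱼ k) (lookup-reflect αᵢ x k) (pairing {j} {i} x (cartan-zero-sym i≢j a≡0)) ⟨
      lookup (reflect αᵢ x) k - ⟨ reflect αᵢ x , coroot αⱼ ⟩ * lookup αⱼ k
        ≡⟨ lookup-reflect αⱼ (reflect αᵢ x) k ⟨
      lookup (reflect αⱼ (reflect αᵢ x)) k ∎

-- Length, reduced words and the exchange property

least-satisfies : ∀ {P : ℕ → Set} (P? : Decidable P) b → P b → P (least P? b)
-- Here `least` falls back on its default, the bound, which is why the bound itself must satisfy P.
least-satisfies P? zero    pb = pb
least-satisfies P? (suc b) pb with P? zero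
... | yes p = p
... | no  _ = least-satisfies (P? ∘ suc) b pb

least-≤ : ∀ {P : ℕ → Set} (P? : Decidable P) b {k} → P k → least P? b ℕ.≤ k
least-≤ P? zero    pk = z≤n
least-≤ P? (suc b) pk with P? zero
least-≤ P? (suc b)         pk | yes _ = z≤n
least-≤ P? (suc b) {zero}  pk | no ¬p = contradiction pk ¬p
least-≤ P? (suc b) {suc k} pk | no ¬p = s≤s (least-≤ (P? ∘ suc) b pk)

wordsOfLength-complete : ∀ {n} (w : Word n) → w ∈ˡ wordsOfLength (length w)
wordsOfLength-complete []      = here refl
wordsOfLength-complete (s ∷ w) = ∈-cartesianProductWith⁺ _∷_ (∈-allFin s) (wordsOfLength-complete w)

wordsOfLength-sound : ∀ {n} k {w : Word n} → w ∈ˡ wordsOfLength k → length w ≡ k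
wordsOfLength-sound zero    (here refl) = refl
wordsOfLength-sound (suc k) w∈ with ∈-cartesianProductWith⁻ _∷_ (allFin _) (wordsOfLength k) w∈
... | s , u , _ , u∈ , refl = cong suc (wordsOfLength-sound k u∈)

module Length {n : ℕ} (R : RootSystem n) where
  open RootSystem R
  open WeylGroup R
  open Basics R

  -- Only the coordinate at k changes, so every other coordinate of γ is both nonnegative and
  -- nonpositive. Thus γ is a multiple of αₖ, and `reduced` with positivity leaves the factor 1.
  positive-made-negative : ∀ {γ} k → γ ∈ˡ roots → Nonneg γ → Nonpos (reflect (simple k) γ) → γ ≡ simple k
  positive-made-negative {γ} k γ∈ γ≥0 sγ≤0 = trans γ≡ (trans (cong (_· simple k) c≡1) 1·)
    where
    c = lookup γ k
    γ≡ : γ ≡ c · simple k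
    γ≡ = vec-ext entry
      where
      entry : ∀ j → lookup γ j ≡ lookup (c · simple k) j
      entry j with k ≟ j
      ... | yes refl = sym (trans (lookup-· c (simple k) k) (trans (cong (c *_) (lookup-simple-refl k)) (ℤ.*-identityʳ c)))
      ... | no  k≢j  = trans (ℤ.≤-antisym (subst (_≤ 0ℤ) (lookup-reflect-≢ γ k≢j) (lookup⁺ sγ≤0 j)) (lookup⁺ γ≥0 j))
                        (sym (trans (lookup-· c (simple k) j) (trans (cong (c *_) (lookup-simple-≢ k≢j)) (ℤ.*-zeroʳ c))))
    c≡1 : c ≡ 1ℤ
    c≡1 with reduced c (simple-root k) (subst (_∈ˡ roots) γ≡ γ∈)
    ... | inj₁ c≡1 = c≡1
    ... | inj₂ c≡-1 with subst (0ℤ ≤_) c≡-1 (lookup⁺ γ≥0 k)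
    ...   | ()
    1· : 1ℤ · simple k ≡ simple k
    1· = vec-ext λ j → trans (lookup-· 1ℤ (simple k) j) (ℤ.*-identityˡ _)

  -- x sᵢ x⁻¹ and sₖ are reflections in the same root αₖ.  They send αⱼ to
  -- αⱼ - g αₖ and αⱼ - h αₖ, so their two products send it to αⱼ ± (g - h) αₖ,
  -- and both of these are positive roots when j ≢ k.
  module _ (x : Word n) {i k : Fin n} (xαᵢ≡αₖ : act x (simple i) ≡ simple k) where
    private
      f = coroot (simple i)
      h = coroot (simple k)

      -- The coroot of αᵢ transported by x. Below, `B` is the reflection x sᵢ x⁻¹, and `g≡h`
      -- identifies the transported coroot with that of αₖ.
      g : Vec ℤ n → ℤ
      g z = ⟨ act (reverse x) z , f ⟩

      g-linear : Linear g
      g-linear = act-linear (reverse x) (⟨,⟩-linear f)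

      B : Vec ℤ n → Vec ℤ n
      B z = act x (reflect (simple i) (act (reverse x) z))

      linear-B : ∀ {L} → Linear L → ∀ z → L (B z) ≡ L z - g z * L (simple k)
      linear-B {L} lin z = trans (linear-reflect (act-linear x lin) (simple i) (act (reverse x) z))
        (cong₂ (λ p q → L p - g z * L q) (act-reverse′ x z) xαᵢ≡αₖ)

      B-root : ∀ {z} → z ∈ˡ roots → B z ∈ˡ roots
      B-root z∈ = act-root x (reflect-root (simple-root i) (act-root (reverse x) z∈))

      g-αₖ : g (simple k) ≡ 1ℤ + 1ℤ
      g-αₖ = trans (cong (λ z → ⟨ z , f ⟩) (trans (cong (act (reverse x)) (sym xαᵢ≡αₖ)) (act-reverse x (simple i)))) (cartan-self i)

      module _ {j : Fin n} (k≢j : k ≢ j) where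
        open ≡-Reasoning
        αⱼ = simple j
        A = reflect (simple k) (B αⱼ)
        A′ = B (reflect (simple k) αⱼ)
        gⱼ = g αⱼ
        hⱼ = ⟨ αⱼ , h ⟩

        A-j : lookup A j ≡ 1ℤ
        A-j = begin
          lookup A j                                    ≡⟨ lookup-reflect-≢ (B αⱼ) k≢j ⟩
          lookup (B αⱼ) j                               ≡⟨ linear-B (lookup-linear j) αⱼ ⟩
          lookup αⱼ j - gⱼ * lookup (simple k) j        ≡⟨ cong₂ (λ p q → p - gⱼ * q) (lookup-simple-refl j) (lookup-simple-≢ k≢j) ⟩
          1ℤ - gⱼ * 0ℤ                                  ≡⟨ cong (λ y → 1ℤ - y) (ℤ.*-zeroʳ gⱼ) ⟩
          1ℤ                                            ∎

        A-k : lookup A k ≡ gⱼ - hⱼ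
        A-k = begin
          lookup A k                                    ≡⟨ lookup-reflect-refl k (B αⱼ) ⟩
          lookup (B αⱼ) k - ⟨ B αⱼ , h ⟩                ≡⟨ cong₂ _-_ (linear-B (lookup-linear k) αⱼ) (linear-B (⟨,⟩-linear h) αⱼ) ⟩
          (lookup αⱼ k - gⱼ * lookup (simple k) k) - (hⱼ - gⱼ * cartan k k)
            ≡⟨ cong₂ (λ p q → p - (hⱼ - gⱼ * q))
                 (cong₂ (λ p q → p - gⱼ * q) (lookup-simple-≢ (k≢j ∘ sym)) (lookup-simple-refl k)) (cartan-self k) ⟩
          (0ℤ - gⱼ * 1ℤ) - (hⱼ - gⱼ * (1ℤ + 1ℤ))        ≡⟨ lemma gⱼ hⱼ ⟩
          gⱼ - hⱼ                                       ∎
          where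
          lemma : ∀ g h → (0ℤ - g * 1ℤ) - (h - g * (1ℤ + 1ℤ)) ≡ g - h
          lemma = solve-∀

        A′-j : lookup A′ j ≡ 1ℤ
        A′-j = begin
          lookup A′ j
            ≡⟨ linear-B (lookup-linear j) (reflect (simple k) αⱼ) ⟩
          lookup (reflect (simple k) αⱼ) j - g (reflect (simple k) αⱼ) * lookup (simple k) j
            ≡⟨ cong₂ (λ p q → p - g (reflect (simple k) αⱼ) * q)
                 (trans (lookup-reflect-≢ αⱼ k≢j) (lookup-simple-refl j)) (lookup-simple-≢ k≢j) ⟩
          1ℤ - g (reflect (simple k) αⱼ) * 0ℤ
            ≡⟨ cong (λ y → 1ℤ - y) (ℤ.*-zeroʳ (g (reflect (simple k) αⱼ))) ⟩
          1ℤ ∎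

        A′-k : lookup A′ k ≡ hⱼ - gⱼ
        A′-k = begin
          lookup A′ k
            ≡⟨ linear-B (lookup-linear k) (reflect (simple k) αⱼ) ⟩
          lookup (reflect (simple k) αⱼ) k - g (reflect (simple k) αⱼ) * lookup (simple k) k
            ≡⟨ cong₂ (λ p q → p - q * lookup (simple k) k) (lookup-reflect-refl k αⱼ) (linear-reflect g-linear (simple k) αⱼ) ⟩
          (lookup αⱼ k - hⱼ) - (gⱼ - hⱼ * g (simple k)) * lookup (simple k) k
            ≡⟨ cong₂ (λ p q → (p - hⱼ) - (gⱼ - hⱼ * q) * lookup (simple k) k) (lookup-simple-≢ (k≢j ∘ sym)) g-αₖ ⟩
          (0ℤ - hⱼ) - (gⱼ - hⱼ * (1ℤ + 1ℤ)) * lookup (simple k) k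
            ≡⟨ cong (λ p → (0ℤ - hⱼ) - (gⱼ - hⱼ * (1ℤ + 1ℤ)) * p) (lookup-simple-refl k) ⟩
          (0ℤ - hⱼ) - (gⱼ - hⱼ * (1ℤ + 1ℤ)) * 1ℤ
            ≡⟨ lemma gⱼ hⱼ ⟩
          hⱼ - gⱼ ∎
          where
          lemma : ∀ g h → (0ℤ - h) - (g - h * (1ℤ + 1ℤ)) * 1ℤ ≡ h - g
          lemma = solve-∀

        g≡h-≢ : gⱼ ≡ hⱼ
        g≡h-≢ = ℤ.≤-antisym
          (ℤ.0≤i-j⇒j≤i (subst (0ℤ ≤_) A′-k (lookup⁺ (positive-coordinate j (B-root (reflect-root (simple-root k) (simple-root j))) A′-j) k)))
          (ℤ.0≤i-j⇒j≤i (subst (0ℤ ≤_) A-k (lookup⁺ (positive-coordinate j (reflect-root (simple-root k) (B-root (simple-root j))) A-j) k)))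

      g≡h : ∀ z → g z ≡ ⟨ z , h ⟩
      g≡h = linear-ext g-linear (⟨,⟩-linear h) on-simple
        where
        on-simple : ∀ j → g (simple j) ≡ ⟨ simple j , h ⟩
        on-simple j with k ≟ j
        ... | yes refl = trans g-αₖ (sym (cartan-self k))
        ... | no  k≢j  = g≡h-≢ k≢j

    conjugate-reflection : x ++ [ i ] ≋ k ∷ x
    conjugate-reflection = ⌜ (λ j → vec-ext λ m → begin
      lookup (act (x ++ [ i ]) (simple j)) m
        ≡⟨ cong (λ y → lookup y m) (act-++ x [ i ] (simple j)) ⟩
      lookup (act x (reflect (simple i) (simple j))) m
        ≡⟨ cong (λ y → lookup (act x (reflect (simple i) y)) m) (act-reverse x (simple j)) ⟨
      lookup (B (act x (simple j))) m
        ≡⟨ linear-B (lookup-linear m) (act x (simple j)) ⟩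
      lookup (act x (simple j)) m - g (act x (simple j)) * lookup (simple k) m
        ≡⟨ cong (λ y → lookup (act x (simple j)) m - y * lookup (simple k) m) (g≡h (act x (simple j))) ⟩
      lookup (act x (simple j)) m - ⟨ act x (simple j) , h ⟩ * lookup (simple k) m
        ≡⟨ lookup-reflect (simple k) (act x (simple j)) m ⟨
      lookup (act (k ∷ x) (simple j)) m ∎) ⌝
      where open ≡-Reasoning

  -- Applying the letters of w to αᵢ from the right, the root first turns negative at some letter k,
  -- just before which it equals αₖ. If x is the part of w after k, then x sᵢ = sₖ x, so k cancels.
  -- As the new word arises by deleting a letter, it inherits P.
  exchange : ∀ {P : Fin n → Set} w i → All P w → Nonpos (act w (simple i)) →
             ∃[ u ] All P u × suc (length u) ≡ length w × u ≋ w ++ [ i ]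
  exchange [] i _ neg with subst (_≤ 0ℤ) (lookup-simple-refl i) (lookup⁺ neg i)
  ... | ℤ.+≤+ ()
  exchange (k ∷ x) i (pk ∷ px) neg with positive-or-negative (act-simple-root x i)
  ... | inj₁ γ≥0 = x , px , refl , (begin
    x                  ≈⟨ cancel-double k x ⟨
    k ∷ k ∷ x          ≈⟨ ++-congˡ [ k ] (conjugate-reflection x (positive-made-negative k (act-simple-root x i) γ≥0 neg)) ⟨
    k ∷ (x ++ [ i ])   ∎)
    where open ≋-Reasoning
  ... | inj₂ γ≤0 with exchange x i px γ≤0
  ...   | u , pu , len , eq = k ∷ u , pk ∷ pu , cong suc len , ++-congˡ [ k ] eq

  ℓ-reduced-word : ∀ w → ∃[ u ] length u ≡ ℓ w × u ≋ w
  ℓ-reduced-word w with find (least-satisfies (λ k → any? (_≈? w) (wordsOfLength k)) (length w) (lose (wordsOfLength-complete w) (⌞_⌟ {w} ≋-refl)))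
  ... | u , u∈ , u≈w = u , wordsOfLength-sound (ℓ w) u∈ , ⌜ u≈w ⌝

  ℓ-≤-length : ∀ {u w} → u ≋ w → ℓ w ℕ.≤ length u
  ℓ-≤-length {u} {w} ⌜ u≈w ⌝ = least-≤ (λ k → any? (_≈? w) (wordsOfLength k)) (length w) (lose (wordsOfLength-complete u) u≈w)

  ℓ-cong : ∀ {v w} → v ≋ w → ℓ v ≡ ℓ w
  ℓ-cong v≋w = ℕ.≤-antisym (half (≋-sym v≋w)) (half v≋w)
    where
    half : ∀ {v w} → v ≋ w → ℓ w ℕ.≤ ℓ v
    half {v} {w} v≋w with ℓ-reduced-word v
    ... | u , len , u≋v = subst (ℓ w ℕ.≤_) len (ℓ-≤-length (≋-trans u≋v v≋w))

  reduced-word : ∀ w → ∃[ u ] Reduced u × u ≋ w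
  reduced-word w with ℓ-reduced-word w
  ... | u , len , u≋w = u , trans len (sym (ℓ-cong u≋w)) , u≋w

  ℓ-++-≤ : ∀ u v → ℓ (u ++ v) ℕ.≤ ℓ u ℕ.+ ℓ v
  ℓ-++-≤ u v with ℓ-reduced-word u | ℓ-reduced-word v
  ... | u′ , lu , u′≋u | v′ , lv , v′≋v =
    subst (ℓ (u ++ v) ℕ.≤_) (trans (List.length-++ u′) (cong₂ ℕ._+_ lu lv)) (ℓ-≤-length (++-cong u′≋u v′≋v))

  ℓ-reverse : ∀ w → ℓ (reverse w) ≡ ℓ w
  ℓ-reverse w = ℕ.≤-antisym (half w) (subst (λ u → ℓ u ℕ.≤ ℓ (reverse w)) (List.reverse-involutive w) (half (reverse w)))
    where
    half : ∀ w → ℓ (reverse w) ℕ.≤ ℓ w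
    half w with ℓ-reduced-word w
    ... | u , len , u≋w = subst (ℓ (reverse w) ℕ.≤_) (trans (List.length-reverse u) len) (ℓ-≤-length (reverse-cong u≋w))

  ++-double : ∀ w i → (w ++ [ i ]) ++ [ i ] ≋ w
  ++-double w i = begin
    (w ++ [ i ]) ++ [ i ]  ≡⟨ List.++-assoc w [ i ] [ i ] ⟩
    w ++ (i ∷ i ∷ [])      ≈⟨ ++-congˡ w (cancel-double i []) ⟩
    w ++ []                ≡⟨ List.++-identityʳ w ⟩
    w                      ∎
    where open ≋-Reasoning

  ℓ-≤-self : ∀ w → ℓ w ℕ.≤ length w
  ℓ-≤-self w = ℓ-≤-length {w} ≋-refl

  ℓ-down : ∀ w i → Nonpos (act w (simple i)) → suc (ℓ (w ++ [ i ])) ≡ ℓ w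
  ℓ-down w i neg with ℓ-reduced-word w
  ... | u , len , u≋w
    with exchange {λ _ → ⊤} u i (All.universal (λ _ → tt) u) (subst Nonpos (sym (≋⇒act≡ u≋w (simple i))) neg)
  ...   | x , _ , len′ , x≋ = ℕ.≤-antisym
    (subst (suc (ℓ (w ++ [ i ])) ℕ.≤_) (trans len′ len) (s≤s (ℓ-≤-length (≋-trans x≋ (++-congʳ [ i ] u≋w)))))
    (begin
      ℓ w                        ≡⟨ ℓ-cong (++-double w i) ⟨
      ℓ ((w ++ [ i ]) ++ [ i ])  ≤⟨ ℓ-++-≤ (w ++ [ i ]) [ i ] ⟩
      ℓ (w ++ [ i ]) ℕ.+ ℓ [ i ] ≤⟨ ℕ.+-monoʳ-≤ (ℓ (w ++ [ i ])) (ℓ-≤-self [ i ]) ⟩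
      ℓ (w ++ [ i ]) ℕ.+ 1       ≡⟨ ℕ.+-comm (ℓ (w ++ [ i ])) 1 ⟩
      suc (ℓ (w ++ [ i ]))       ∎)
    where open ℕ.≤-Reasoning

  linear-neg-simple : ∀ {L} → Linear L → ∀ i → L (act [ i ] (simple i)) ≡ - L (simple i)
  linear-neg-simple {L} lin i = begin
    L (act [ i ] (simple i))                ≡⟨ linear-reflect lin (simple i) (simple i) ⟩
    L (simple i) - cartan i i * L (simple i) ≡⟨ cong (λ c → L (simple i) - c * L (simple i)) (cartan-self i) ⟩
    L (simple i) - (1ℤ + 1ℤ) * L (simple i)  ≡⟨ lemma (L (simple i)) ⟩
    - L (simple i)                           ∎
    where
    open ≡-Reasoning
    lemma : ∀ x → x - (1ℤ + 1ℤ) * x ≡ - x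
    lemma = solve-∀

  lookup-act-∷ʳ-self : ∀ w i k → lookup (act (w ++ [ i ]) (simple i)) k ≡ - lookup (act w (simple i)) k
  lookup-act-∷ʳ-self w i k = trans (cong (λ y → lookup y k) (act-++ w [ i ] (simple i)))
    (linear-neg-simple (act-linear w (lookup-linear k)) i)

  ∷ʳ-nonpos : ∀ w i → Nonneg (act w (simple i)) → Nonpos (act (w ++ [ i ]) (simple i))
  ∷ʳ-nonpos w i pos = lookup⁻ λ k → subst (_≤ 0ℤ) (sym (lookup-act-∷ʳ-self w i k)) (ℤ.neg-mono-≤ (lookup⁺ pos k))

  -- This is `ℓ-down` for w sᵢ, which sends αᵢ to a negative root.
  ℓ-up : ∀ w i → Nonneg (act w (simple i)) → ℓ (w ++ [ i ]) ≡ suc (ℓ w)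
  ℓ-up w i pos = trans (sym (ℓ-down (w ++ [ i ]) i (∷ʳ-nonpos w i pos))) (cong suc (ℓ-cong (++-double w i)))

  ℓ-∷ : ∀ i w → ℓ (i ∷ w) ≡ ℓ (reverse w ++ [ i ])
  ℓ-∷ i w = trans (sym (ℓ-reverse (i ∷ w))) (cong ℓ (List.unfold-reverse i w))

  ℓ-upˡ : ∀ i w → Nonneg (act (reverse w) (simple i)) → ℓ (i ∷ w) ≡ suc (ℓ w)
  ℓ-upˡ i w pos = trans (ℓ-∷ i w) (trans (ℓ-up (reverse w) i pos) (cong suc (ℓ-reverse w)))

  ℓ-downˡ : ∀ i w → Nonpos (act (reverse w) (simple i)) → suc (ℓ (i ∷ w)) ≡ ℓ w
  ℓ-downˡ i w neg = trans (cong suc (ℓ-∷ i w)) (trans (ℓ-down (reverse w) i neg) (ℓ-reverse w))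

  ℓ-[] : ℓ [] ≡ 0
  ℓ-[] = ℕ.n≤0⇒n≡0 (ℓ-≤-self [])

  ℓ≡0⇒≋[] : ∀ {w} → ℓ w ≡ 0 → w ≋ []
  ℓ≡0⇒≋[] {w} eq with ℓ-reduced-word w
  ... | []    , _   , []≋w = ≋-sym []≋w
  ... | _ ∷ _ , len , _    = contradiction (trans len eq) λ ()

  reduced-++ : ∀ u v → Reduced (u ++ v) → Reduced u × Reduced v
  reduced-++ u v red = ℕ.≤-antisym (ℕ.+-cancelʳ-≤ (length v) (length u) (ℓ u) (begin
      length u ℕ.+ length v ≤⟨ total ⟩
      ℓ u ℕ.+ ℓ v           ≤⟨ ℕ.+-monoʳ-≤ (ℓ u) (ℓ-≤-self v) ⟩
      ℓ u ℕ.+ length v      ∎)) (ℓ-≤-self u)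
    , ℕ.≤-antisym (ℕ.+-cancelˡ-≤ (length u) (length v) (ℓ v) (begin
      length u ℕ.+ length v ≤⟨ total ⟩
      ℓ u ℕ.+ ℓ v           ≤⟨ ℕ.+-monoˡ-≤ (ℓ v) (ℓ-≤-self u) ⟩
      length u ℕ.+ ℓ v      ∎)) (ℓ-≤-self v)
    where
    open ℕ.≤-Reasoning
    total : length u ℕ.+ length v ℕ.≤ ℓ u ℕ.+ ℓ v
    total = subst (ℕ._≤ ℓ u ℕ.+ ℓ v) (trans (sym red) (List.length-++ u)) (ℓ-++-≤ u v)

-- Parabolic subgroups and minimal coset representatives

All-reverse : ∀ {A : Set} {P : A → Set} {xs} → All P xs → All P (reverse xs)
All-reverse pxs = All.tabulate (All.lookup pxs ∘ Any.reverse⁻)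

module Parabolic {n : ℕ} (R : RootSystem n) where
  open RootSystem R
  open WeylGroup R
  open Basics R
  open Length R

  reduced-∷ʳ : ∀ u i → Reduced u → Nonneg (act u (simple i)) → Reduced (u ++ [ i ])
  reduced-∷ʳ u i red pos = begin
    length (u ++ [ i ])   ≡⟨ List.length-++-comm u [ i ] ⟩
    suc (length u)        ≡⟨ cong suc red ⟩
    suc (ℓ u)             ≡⟨ ℓ-up u i pos ⟨
    ℓ (u ++ [ i ])        ∎
    where open ≡-Reasoning

  reduced-exchange : ∀ u i y → Reduced u → Nonpos (act u (simple i)) →
                     suc (length y) ≡ length u → y ≋ u ++ [ i ] → Reduced y
  reduced-exchange u i y red neg len y≋ = ℕ.suc-injective (begin
    suc (length y)        ≡⟨ len ⟩
    length u              ≡⟨ red ⟩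
    ℓ u                   ≡⟨ ℓ-down u i neg ⟨
    suc (ℓ (u ++ [ i ]))  ≡⟨ cong suc (ℓ-cong y≋) ⟨
    suc (ℓ y)             ∎)
    where open ≡-Reasoning

  -- Letters are appended one by one to a reduced word; a letter that would lower the length is
  -- absorbed by `exchange`, which brings in no new letters.
  reduce : ∀ {P : Fin n → Set} w → All P w → ∃[ u ] All P u × Reduced u × u ≋ w
  reduce {P} = go [] [] (sym ℓ-[])
    where
    open ≋-Reasoning
    go : ∀ u → All P u → Reduced u → ∀ w → All P w → ∃[ x ] All P x × Reduced x × x ≋ u ++ w
    go u pu red []      []        = u , pu , red , ≋-reflexive (sym (List.++-identityʳ u))
    go u pu red (i ∷ w) (pi ∷ pw) = [ up , down ]′ (positive-or-negative (act-simple-root u i))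
      where
      up : Nonneg (act u (simple i)) → ∃[ x ] All P x × Reduced x × x ≋ u ++ i ∷ w
      up pos =
        let x , px , redx , x≋ = go (u ++ [ i ]) (All.++⁺ pu (pi ∷ [])) (reduced-∷ʳ u i red pos) w pw
        in x , px , redx , ≋-trans x≋ (≋-reflexive (List.++-assoc u [ i ] w))
      down : Nonpos (act u (simple i)) → ∃[ x ] All P x × Reduced x × x ≋ u ++ i ∷ w
      down neg =
        let y , py , len , y≋ = exchange u i pu neg
            x , px , redx , x≋ = go y py (reduced-exchange u i y red neg len y≋) w pw
        in x , px , redx , (begin
          x                   ≈⟨ x≋ ⟩
          y ++ w              ≈⟨ ++-congʳ w y≋ ⟩
          (u ++ [ i ]) ++ w   ≡⟨ List.++-assoc u [ i ] w ⟩
          u ++ i ∷ w          ∎)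

  lookup-act-≢ : ∀ {k} u v → All (_≢ k) u → lookup (act u v) k ≡ lookup v k
  lookup-act-≢ []      v []        = refl
  lookup-act-≢ (i ∷ u) v (i≢k ∷ p) = trans (lookup-reflect-≢ (act u v) i≢k) (lookup-act-≢ u v p)

  reduced-∷ʳ-nonneg : ∀ x i → Reduced (x ++ [ i ]) → Nonneg (act x (simple i))
  reduced-∷ʳ-nonneg x i red with positive-or-negative (act-simple-root x i)
  ... | inj₁ pos = pos
  ... | inj₂ neg = contradiction (begin
    suc (ℓ (x ++ [ i ]))       ≡⟨ ℓ-down x i neg ⟩
    ℓ x                        ≤⟨ ℓ-≤-self x ⟩
    length x                   ≤⟨ ℕ.n≤1+n (length x) ⟩
    suc (length x)             ≡⟨ List.length-++-comm x [ i ] ⟨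
    length (x ++ [ i ])        ≡⟨ red ⟩
    ℓ (x ++ [ i ])             ∎) (ℕ.<-irrefl refl)
    where open ℕ.≤-Reasoning

  -- If the last letter i violated P, the word u would not touch coordinate i, so αᵢ would keep its
  -- coordinate 1 there; but a reduced word ending in i makes αᵢ negative. The rest of x is then
  -- represented by `u ++ [ i ]`.
  reduced-letters : ∀ {P : Fin n → Set} → Decidable P → ∀ {x u} → Reduced x → All P u → u ≋ x → All P x
  reduced-letters {P} P? {x} = go (reverseView x)
    where
    go : ∀ {x u} → Reverse x → Reduced x → All P u → u ≋ x → All P x
    go []            red pu u≋x = []
    go {u = u} (x ∶ rx ∶ʳ i) red pu u≋x = All.++⁺ (go rx (proj₁ (reduced-++ x [ i ] red)) (All.++⁺ pu (last-letter ∷ [])) (begin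
      u ++ [ i ]              ≈⟨ ++-congʳ [ i ] u≋x ⟩
      (x ++ [ i ]) ++ [ i ]   ≈⟨ ++-double x i ⟩
      x                       ∎)) (last-letter ∷ [])
      where
      open ≋-Reasoning
      last-letter : P i
      last-letter = decidable-stable (P? i) λ ¬pi →
        nonneg-nonpos-root (act-simple-root (x ++ [ i ]) i)
          (positive-coordinate i (act-simple-root (x ++ [ i ]) i) (≡.begin
            lookup (act (x ++ [ i ]) (simple i)) i  ≡.≡⟨ cong (λ y → lookup y i) (≋⇒act≡ u≋x (simple i)) ⟨
            lookup (act u (simple i)) i             ≡.≡⟨ lookup-act-≢ u (simple i) (All.map (λ { pj refl → ¬pi pj }) pu) ⟩
            lookup (simple i) i                     ≡.≡⟨ lookup-simple-refl i ⟩
            1ℤ                                      ≡.∎))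
          (∷ʳ-nonpos x i (reduced-∷ʳ-nonneg x i red))
        where module ≡ = ≡-Reasoning

  _∈?_ : ∀ i (K : List (Fin n)) → Dec (i ∈ˡ K)
  i ∈? K = any? (i ≟_) K

  ∈W-reduced-word : ∀ {K} w → w ∈W K → ∃[ u ] All (_∈ˡ K) u × Reduced u × u ≋ w
  ∈W-reduced-word w (u , pu , u≈w) with reduce u pu
  ... | x , px , red , x≋u = x , px , red , ≋-trans x≋u (⌜_⌝ {u} {w} u≈w)

  ∈W-letters : ∀ {K} w → w ∈W K → Reduced w → All (_∈ˡ K) w
  ∈W-letters {K} w (u , pu , u≈w) red = reduced-letters (_∈? K) red pu (⌜_⌝ {u} {w} u≈w)

  letters-∈W : ∀ {K w} → All (_∈ˡ K) w → w ∈W K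
  letters-∈W {w = w} pw = w , pw , ⌞_⌟ {w} ≋-refl

  ∈W-resp : ∀ {K v w} → v ≋ w → v ∈W K → w ∈W K
  ∈W-resp {K} {v} v≋w (u , pu , u≈v) = u , pu , ⌞ ≋-trans (⌜_⌝ {u} {v} u≈v) v≋w ⌟

  ∈W-++ : ∀ {K} v w → v ∈W K → w ∈W K → v ++ w ∈W K
  ∈W-++ v w (u , pu , u≈v) (u′ , pu′ , u′≈w) = u ++ u′ , All.++⁺ pu pu′ , ⌞ ++-cong {u} {v} {u′} {w} ⌜ u≈v ⌝ ⌜ u′≈w ⌝ ⌟

  ∈W-reverse : ∀ {K} w → w ∈W K → reverse w ∈W K
  ∈W-reverse w (u , pu , u≈w) = reverse u , All-reverse pu , ⌞ reverse-cong {u} {w} ⌜ u≈w ⌝ ⌟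

  ∈W-there : ∀ {s K} w → w ∈W K → w ∈W (s ∷ K)
  ∈W-there w (u , pu , u≈w) = u , All.map there pu , u≈w

  -- This says that v has minimal length in its coset W_J v.
  Shortest : List (Fin n) → Word n → Set
  Shortest J v = ∀ {j} → j ∈ˡ J → Nonneg (act (reverse v) (simple j))

  -- Passes by linearity from the simple roots of J to every nonnegative vector in their span.
  shortest-nonneg : ∀ {J} v {γ} → Shortest J v → Nonneg γ → (∀ i → i ∉ˡ J → lookup γ i ≡ 0ℤ) → Nonneg (act (reverse v) γ)
  shortest-nonneg {J} v {γ} short γ≥0 supp = lookup⁻ λ k →
    linear-nonneg (act-linear (reverse v) (lookup-linear k)) γ≥0 λ i γᵢ≢0 → lookup⁺ (short (in-support i γᵢ≢0)) k
    where
    in-support : ∀ i → lookup γ i ≢ 0ℤ → i ∈ˡ J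
    in-support i γᵢ≢0 with i ∈? J
    ... | yes i∈ = i∈
    ... | no  i∉ = contradiction (supp i i∉) γᵢ≢0

  support : ∀ {J} u {j} → All (_∈ˡ J) u → j ∈ˡ J → ∀ i → i ∉ˡ J → lookup (act u (simple j)) i ≡ 0ℤ
  support u {j} pu j∈ i i∉ = trans (lookup-act-≢ u (simple j) (All.map (λ { k∈ refl → i∉ k∈ }) pu))
    (lookup-simple-≢ {i = j} {i} λ { refl → i∉ j∈ })

  act-reverse-++ : ∀ u v x → act (reverse (u ++ v)) x ≡ act (reverse v) (act (reverse u) x)
  act-reverse-++ u v x = trans (cong (λ w → act w x) (List.reverse-++ u v)) (act-++ (reverse v) (reverse u) x)

  reduced-∷-nonneg : ∀ i u → Reduced (i ∷ u) → Nonneg (act (reverse u) (simple i))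
  reduced-∷-nonneg i u red with positive-or-negative (act-simple-root (reverse u) i)
  ... | inj₁ pos = pos
  ... | inj₂ neg = contradiction (begin
    suc (suc (length u))   ≡⟨ cong suc red ⟩
    suc (ℓ (i ∷ u))        ≡⟨ ℓ-downˡ i u neg ⟩
    ℓ u                    ≤⟨ ℓ-≤-self u ⟩
    length u               ∎) (ℕ.<⇒≱ (s≤s (ℕ.n≤1+n (length u))))
    where open ℕ.≤-Reasoning

  -- Every letter i put in front raises the length: if u is what follows it, u⁻¹αᵢ is a positive
  -- root supported on J, and v⁻¹ keeps it positive.
  ℓ-++-reduced : ∀ {J} u v → All (_∈ˡ J) u → Reduced u → Shortest J v → ℓ (u ++ v) ≡ ℓ u ℕ.+ ℓ v
  ℓ-++-reduced []      v []        red short = cong (ℕ._+ ℓ v) (sym ℓ-[])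
  ℓ-++-reduced (i ∷ u) v (i∈ ∷ pu) red short = begin
    ℓ (i ∷ u ++ v)           ≡⟨ ℓ-upˡ i (u ++ v) (subst Nonneg (sym (act-reverse-++ u v (simple i)))
                                  (shortest-nonneg v short u⁻¹αᵢ≥0 (support (reverse u) (All-reverse pu) i∈))) ⟩
    suc (ℓ (u ++ v))         ≡⟨ cong suc (ℓ-++-reduced u v pu redu short) ⟩
    suc (ℓ u) ℕ.+ ℓ v        ≡⟨ cong (ℕ._+ ℓ v) (ℓ-upˡ i u u⁻¹αᵢ≥0) ⟨
    ℓ (i ∷ u) ℕ.+ ℓ v        ∎
    where
    open ≡-Reasoning
    redu = proj₂ (reduced-++ [ i ] u red)
    u⁻¹αᵢ≥0 = reduced-∷-nonneg i u red

  ℓ-++ : ∀ {J} u v → u ∈W J → Shortest J v → ℓ (u ++ v) ≡ ℓ u ℕ.+ ℓ v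
  ℓ-++ u v u∈ short with ∈W-reduced-word u u∈
  ... | x , px , red , x≋u = begin
    ℓ (u ++ v)      ≡⟨ ℓ-cong (++-congʳ v x≋u) ⟨
    ℓ (x ++ v)      ≡⟨ ℓ-++-reduced x v px red short ⟩
    ℓ x ℕ.+ ℓ v     ≡⟨ cong (ℕ._+ ℓ v) (ℓ-cong x≋u) ⟩
    ℓ u ℕ.+ ℓ v     ∎
    where open ≡-Reasoning

  shortest-resp : ∀ {J v w} → v ≋ w → Shortest J v → Shortest J w
  shortest-resp v≋w short {j} j∈ = subst Nonneg (≋⇒act≡ (reverse-cong v≋w) (simple j)) (short j∈)

  minRep⇒shortest : ∀ {J K} v → MinRep J K v → Shortest J v
  minRep⇒shortest v (_ , min) {j} j∈ with positive-or-negative (act-simple-root (reverse v) j)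
  ... | inj₁ pos = pos
  ... | inj₂ neg = contradiction (min [ j ] (letters-∈W (j∈ ∷ []))) (ℕ.<⇒≱ (ℕ.≤-reflexive (ℓ-downˡ j v neg)))

  shortest⇒minRep : ∀ {J K} v → v ∈W K → Shortest J v → MinRep J K v
  shortest⇒minRep v v∈ short = v∈ , λ u u∈ → subst (ℓ v ℕ.≤_) (sym (ℓ-++ u v u∈ short)) (ℕ.m≤n+m (ℓ v) (ℓ u))

  -- As long as some j in K has w⁻¹αⱼ negative, `exchange` on the reversed word splits off j on the
  -- left. The word that is left is not a subterm of w, so the recursion runs on a bound for the
  -- length.
  factor : ∀ {s K} w → All (_∈ˡ (s ∷ K)) w →
           ∃[ u ] ∃[ v ] All (_∈ˡ K) u × All (_∈ˡ (s ∷ K)) v × Shortest K v × u ++ v ≋ w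
  factor {s} {K} w pw = go (length w) w pw ℕ.≤-refl
    where
    open ≋-Reasoning
    scan : ∀ w L → (∀ {j} → j ∈ˡ L → Nonneg (act (reverse w) (simple j))) ⊎ ∃[ j ] j ∈ˡ L × Nonpos (act (reverse w) (simple j))
    scan w [] = inj₁ λ ()
    scan w (j ∷ L) with positive-or-negative (act-simple-root (reverse w) j) | scan w L
    ... | inj₂ neg | _                   = inj₂ (j , here refl , neg)
    ... | inj₁ pos | inj₂ (k , k∈ , neg) = inj₂ (k , there k∈ , neg)
    ... | inj₁ pos | inj₁ all            = inj₁ λ { (here refl) → pos ; (there k∈) → all k∈ }
    go : ∀ b w → All (_∈ˡ (s ∷ K)) w → length w ℕ.≤ b →
         ∃[ u ] ∃[ v ] All (_∈ˡ K) u × All (_∈ˡ (s ∷ K)) v × Shortest K v × u ++ v ≋ w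
    go b w pw len≤ with scan w K
    ... | inj₁ short = [] , w , [] , pw , short , ≋-refl
    ... | inj₂ (j , j∈ , neg) with exchange (reverse w) j (All-reverse pw) neg
    go zero    w pw len≤ | inj₂ _ | y , py , len , y≋ = contradiction (trans len (trans (List.length-reverse w) (ℕ.n≤0⇒n≡0 len≤))) λ ()
    go (suc b) w pw len≤ | inj₂ (j , j∈ , neg) | y , py , len , y≋
      with go b (reverse y) (All-reverse py)
             (ℕ.s≤s⁻¹ (subst (ℕ._≤ suc b) (sym (trans (cong suc (List.length-reverse y)) (trans len (List.length-reverse w)))) len≤))
    ... | u , v , pu , pv , short , uv≋ = j ∷ u , v , j∈ ∷ pu , pv , short , (begin
      j ∷ u ++ v                   ≈⟨ ++-congˡ [ j ] uv≋ ⟩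
      j ∷ reverse y                ≈⟨ ++-congˡ [ j ] (reverse-cong y≋) ⟩
      j ∷ reverse (reverse w ++ [ j ]) ≡⟨ cong (j ∷_) (List.reverse-++ (reverse w) [ j ]) ⟩
      j ∷ j ∷ reverse (reverse w)  ≡⟨ cong (λ x → j ∷ j ∷ x) (List.reverse-involutive w) ⟩
      j ∷ j ∷ w                    ≈⟨ cancel-double j w ⟩
      w                            ∎)

  -- The element x = u′⁻¹u of W_J carries v to v′, and its inverse carries v′ to v. Lengths add both
  -- times, so ℓ v = ℓ x + ℓ x + ℓ v and x is trivial.
  factor-unique : ∀ {J} u v u′ v′ → u ∈W J → u′ ∈W J → Shortest J v → Shortest J v′ →
                  u ++ v ≋ u′ ++ v′ → u ≋ u′ × v ≋ v′
  factor-unique {J} u v u′ v′ u∈ u′∈ short short′ eq = u≋u′ , ++-cancelˡ u (≋-trans eq (++-congʳ v′ (≋-sym u≋u′)))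
    where
    open ≋-Reasoning
    x = reverse u′ ++ u
    x∈ : x ∈W J
    x∈ = ∈W-++ (reverse u′) u (∈W-reverse u′ u′∈) u∈
    xv≋v′ : x ++ v ≋ v′
    xv≋v′ = begin
      x ++ v                   ≡⟨ List.++-assoc (reverse u′) u v ⟩
      reverse u′ ++ (u ++ v)   ≈⟨ ++-congˡ (reverse u′) eq ⟩
      reverse u′ ++ (u′ ++ v′) ≡⟨ List.++-assoc (reverse u′) u′ v′ ⟨
      x′ ++ v′                 ≈⟨ ++-congʳ v′ (inverseˡ u′) ⟩
      v′                       ∎
      where x′ = reverse u′ ++ u′
    x⁻¹v′≋v : reverse x ++ v′ ≋ v
    x⁻¹v′≋v = begin
      reverse x ++ v′          ≈⟨ ++-congˡ (reverse x) xv≋v′ ⟨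
      reverse x ++ (x ++ v)    ≡⟨ List.++-assoc (reverse x) x v ⟨
      (reverse x ++ x) ++ v    ≈⟨ ++-congʳ v (inverseˡ x) ⟩
      v                        ∎
    ℓx≡0 : ℓ x ≡ 0
    ℓx≡0 = ℕ.m+n≡0⇒m≡0 (ℓ x) (ℕ.+-cancelʳ-≡ (ℓ v) _ 0 (≡.begin
      ℓ x ℕ.+ ℓ x ℕ.+ ℓ v            ≡.≡⟨ ℕ.+-assoc (ℓ x) (ℓ x) (ℓ v) ⟩
      ℓ x ℕ.+ (ℓ x ℕ.+ ℓ v)          ≡.≡⟨ cong (ℓ x ℕ.+_) (trans (sym (ℓ-++ x v x∈ short)) (ℓ-cong xv≋v′)) ⟩
      ℓ x ℕ.+ ℓ v′                   ≡.≡⟨ cong (ℕ._+ ℓ v′) (ℓ-reverse x) ⟨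
      ℓ (reverse x) ℕ.+ ℓ v′         ≡.≡⟨ ℓ-++ (reverse x) v′ (∈W-reverse x x∈) short′ ⟨
      ℓ (reverse x ++ v′)            ≡.≡⟨ ℓ-cong x⁻¹v′≋v ⟩
      ℓ v                            ≡.∎))
      where module ≡ = ≡-Reasoning
    u≋u′ : u ≋ u′
    u≋u′ = begin
      u                          ≈⟨ ++-congʳ u (inverseʳ u′) ⟨
      (u′ ++ reverse u′) ++ u    ≡⟨ List.++-assoc u′ (reverse u′) u ⟩
      u′ ++ x                    ≈⟨ ++-congˡ u′ (ℓ≡0⇒≋[] ℓx≡0) ⟩
      u′ ++ []                   ≡⟨ List.++-identityʳ u′ ⟩
      u′                         ∎

-- Subwords picking out first occurrences

δ : ∀ {n} → Fin n → Fin n → ℕ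
δ i j = if does (i ≟ j) then 1 else 0

δ-refl : ∀ {n} (i : Fin n) → δ i i ≡ 1
δ-refl i = cong (if_then 1 else 0) (dec-true (i ≟ i) refl)

δ-≢ : ∀ {n} {i j : Fin n} → i ≢ j → δ i j ≡ 0
δ-≢ {i = i} {j} i≢j = cong (if_then 1 else 0) (dec-false (i ≟ j) i≢j)

occ : ∀ {n} → Fin n → Word n → ℕ
occ j []      = 0
occ j (i ∷ w) = δ i j ℕ.+ occ j w

occ-↭ : ∀ {n} {v w : Word n} → v ↭ w → ∀ j → occ j v ≡ occ j w
occ-↭ ↭.refl        j = refl
occ-↭ (prep i p)    j = cong (δ i j ℕ.+_) (occ-↭ p j)
occ-↭ (swap i k p) j = trans (cong (λ x → δ i j ℕ.+ (δ k j ℕ.+ x)) (occ-↭ p j)) (x∙yz≈y∙xz (δ i j) (δ k j) _)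
occ-↭ (↭.trans p q) j = trans (occ-↭ p j) (occ-↭ q j)

occ-++ : ∀ {n} (v w : Word n) j → occ j (v ++ w) ≡ occ j v ℕ.+ occ j w
occ-++ []      w j = refl
occ-++ (i ∷ v) w j = trans (cong (δ i j ℕ.+_) (occ-++ v w j)) (sym (ℕ.+-assoc (δ i j) _ _))

positive? : ℕ → Bool
positive? zero    = outside
positive? (suc _) = inside

-- Here m is the allowance left for each letter. Truncated subtraction lets taken and skipped
-- positions share one recursion: a letter is skipped only when its allowance is 0, and then stays
-- at 0.
firsts : ∀ {n} → (Fin n → ℕ) → (ω : Word n) → Subset (length ω)
firsts m []      = []
firsts m (i ∷ ω) = positive? (m i) ∷ firsts (λ j → m j ∸ δ i j) ω

-- `firsts` leaves out a position only when the allowance for its letter is spent, and then J cannot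
-- use it either. An upper bound on occurrences is enough, so the lemma also covers subwords that
-- spell only a prefix.
firsts-least : ∀ {n} {m : Fin n → ℕ} ω J → (∀ j → occ j (subword ω J) ℕ.≤ m j) → firsts m ω ≤lex J
firsts-least []      []      _   = base tt
firsts-least {m = m} (i ∷ ω) (inside ∷ J) occ≤ with m i in eq
... | zero  = contradiction (subst₂ ℕ._≤_ (cong (ℕ._+ occ i (subword ω J)) (δ-refl i)) eq (occ≤ i)) λ ()
... | suc k = next refl (firsts-least ω J λ j → ℕ.m+n≤o⇒m≤o∸n (occ j (subword ω J)) (subst (ℕ._≤ m j) (ℕ.+-comm (δ i j) _) (occ≤ j)))
firsts-least {m = m} (i ∷ ω) (outside ∷ J) occ≤ with m i in eq
-- The comparison of entries is flipped, so `inside` precedes `outside`.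
... | suc k = this Bool.f<t refl
... | zero  = next refl (firsts-least ω J bound)
  where
  bound : ∀ j → occ j (subword ω J) ℕ.≤ m j ∸ δ i j
  bound j with i ≟ j
  ... | yes refl = subst (ℕ._≤ m i ∸ 1) (sym (ℕ.n≤0⇒n≡0 (subst (_ ℕ.≤_) eq (occ≤ i)))) z≤n
  ... | no  i≢j  = occ≤ j

firsts-mono : ∀ {n} {m m′ : Fin n → ℕ} ω → (∀ j → m j ℕ.≤ m′ j) → firsts m ω ⊆ firsts m′ ω
firsts-mono []      _  = λ ()
firsts-mono {m = m} {m′} (i ∷ ω) m≤ with m i | m′ i | m≤ i
... | zero  | _     | _ = out⊆ (firsts-mono ω λ j → ℕ.∸-monoˡ-≤ (δ i j) (m≤ j))
... | suc _ | suc _ | _ = s⊆s (firsts-mono ω λ j → ℕ.∸-monoˡ-≤ (δ i j) (m≤ j))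

-- The bound by `occ j ω` is essential: an allowance beyond the number of occurrences leaves no
-- trace in the set.
firsts-⊆⁻ : ∀ {n} {m m′ : Fin n → ℕ} ω → (∀ j → m j ℕ.≤ occ j ω) → firsts m ω ⊆ firsts m′ ω → ∀ j → m j ℕ.≤ m′ j
firsts-⊆⁻ []      m≤ _ j = subst (ℕ._≤ _) (sym (ℕ.n≤0⇒n≡0 (m≤ j))) z≤n
firsts-⊆⁻ {m = m} {m′} (i ∷ ω) m≤ sub j = from-tail (firsts-⊆⁻ ω (λ j → ℕ.m≤n+o⇒m∸n≤o (m j) (δ i j) (m≤ j)) (drop-∷-⊆ sub) j)
  where
  from-tail : m j ∸ δ i j ℕ.≤ m′ j ∸ δ i j → m j ℕ.≤ m′ j
  from-tail le with i ≟ j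
  ... | no _ = le
  ... | yes refl with m i | m′ i | sub {zero}
  ...   | zero  | _     | _ = z≤n
  ...   | suc k | zero  | s = contradiction (s here) λ ()
  ...   | suc k | suc l | _ = s≤s le

-- The numbers game

module Game {n : ℕ} (R : RootSystem n) (L : List (Fin n)) where
  open Basics R

  State : Set
  State = Fin n → ℤ

  -- Appending sᵢ subtracts `cartan j i * c i` at j; a legal move has `c i` equal to 1, so that
  -- factor is dropped.
  fire : Fin n → State → State
  fire i c j = c j - cartan j i

  data Legal (c : State) : Word n → Set where
    []  : Legal c []
    legal : ∀ {i w} → i ∈ˡ L → c i ≡ 1ℤ → Legal (fire i c) w → Legal c (i ∷ w)

  final : State → Word n → State
  final c []      = c
  final c (i ∷ w) = final (fire i c) w

  legal-resp : ∀ {c d w} → (∀ j → c j ≡ d j) → Legal c w → Legal d w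
  legal-resp eq []             = []
  legal-resp eq (legal {i} i∈ ci leg) = legal i∈ (trans (sym (eq i)) ci) (legal-resp (λ j → cong (_- cartan j i) (eq j)) leg)

  fire-swap : ∀ i j c k → fire i (fire j c) k ≡ fire j (fire i c) k
  fire-swap i j c k = swap-minus (c k) (cartan k i) (cartan k j)
    where
    swap-minus : ∀ x y z → x - z - y ≡ x - y - z
    swap-minus = solve-∀

  module Bounded (Red : Word n → Set)
                 (red-suffix : ∀ i w → Red (i ∷ w) → Red w)
                 (red-minimal : ∀ u v → Red u → u ≋ v → length u ℕ.≤ length v)
    where

    -- Quantifying over all legal continuations makes the property pass to every position that can
    -- be reached.
    Good : State → Set
    Good c = ∀ {w} → Legal c w → Red w × (∀ {i} → i ∈ˡ L → final c w i ≤ 1ℤ)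

    good-fire : ∀ {c i} → Good c → i ∈ˡ L → c i ≡ 1ℤ → Good (fire i c)
    good-fire {i = i} good i∈ ci {w} leg = red-suffix i w (proj₁ (good (legal i∈ ci leg))) , proj₂ (good (legal i∈ ci leg))

    -- Firing j leaves `1ℤ - cartan i j` at i. The bound 1 forces the Cartan integer to be
    -- nonnegative, and for distinct letters it is nonpositive.
    good-orthogonal : ∀ {c i j} → Good c → i ≢ j → i ∈ˡ L → c i ≡ 1ℤ → j ∈ˡ L → c j ≡ 1ℤ → cartan i j ≡ 0ℤ
    good-orthogonal {c} {i} {j} good i≢j i∈ ci j∈ cj = ℤ.≤-antisym (cartan-nonpos (i≢j ∘ sym))
      (subst (0ℤ ≤_) (cancel (cartan i j)) (ℤ.i≤j⇒0≤j-i (subst (λ x → x - cartan i j ≤ 1ℤ) ci (proj₂ (good (legal j∈ cj [])) i∈))))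
      where
      cancel : ∀ x → 1ℤ - (1ℤ - x) ≡ x
      cancel = solve-∀

    fire-orthogonal : ∀ c i j → cartan i j ≡ 0ℤ → c i ≡ 1ℤ → fire j c i ≡ 1ℤ
    fire-orthogonal c i j a≡0 ci = cong₂ _-_ ci a≡0

    -- In both cases i can be fired at once; what differs is whether this uses up an i of w or
    -- leaves w intact as a continuation.
    data Extract (c : State) (i : Fin n) (w : Word n) : Set where
      absent  : occ i w ≡ 0 → Legal (fire i c) w → Extract c i w
      present : ∀ w′ → w ↭ i ∷ w′ → w ≋ i ∷ w′ → Legal (fire i c) w′ → Extract c i w

    -- While i can be fired, firing a neighbour of i would push its value
    -- above 1, so every letter played before i commutes with i.
    extract : ∀ {c i w} → Good c → i ∈ˡ L → c i ≡ 1ℤ → Legal c w → Extract c i w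
    extract good i∈ ci [] = absent refl []
    extract {c} {i} {j ∷ w} good i∈ ci (legal j∈ cj leg) with i ≟ j
    ... | yes refl = present w ↭-refl ≋-refl leg
    ... | no  i≢j  = prepend (extract (good-fire good j∈ cj) i∈ (fire-orthogonal c i j aᵢⱼ ci) leg)
      where
      aᵢⱼ : cartan i j ≡ 0ℤ
      aᵢⱼ = good-orthogonal good i≢j i∈ ci j∈ cj
      aⱼᵢ : cartan j i ≡ 0ℤ
      aⱼᵢ = good-orthogonal good (i≢j ∘ sym) j∈ cj i∈ ci
      prepend : Extract (fire j c) i w → Extract c i (j ∷ w)
      prepend (absent occ≡0 leg′) = absent (trans (cong (ℕ._+ occ i w) (δ-≢ (i≢j ∘ sym))) occ≡0)
        (legal j∈ (fire-orthogonal c j i aⱼᵢ cj) (legal-resp (fire-swap i j c) leg′))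
      prepend (present w′ perm eq leg′) = present (j ∷ w′) (↭-trans (prep j perm) (swap j i ↭-refl))
        (≋-trans (++-congˡ [ j ] eq) (commute (i≢j ∘ sym) aᵢⱼ w′))
        (legal j∈ (fire-orthogonal c j i aⱼᵢ cj) (legal-resp (fire-swap i j c) leg′))

    occ-zero : ∀ {w : Word n} → (∀ j → occ j w ≡ 0) → w ≡ []
    occ-zero {[]}    _  = refl
    occ-zero {i ∷ w} eq = contradiction (trans (cong (ℕ._+ occ i w) (sym (δ-refl i))) (eq i)) λ ()

    -- The state follows all of ω, skipped letters included. At a letter i of ω, either v contains
    -- i, which is moved to its front and taken, or v is still legal after i has been fired. In both
    -- cases the two plays continue from the same state.
    subword-firsts : ∀ {c ω v} m → Good c → Legal c ω → Legal c v →
                     (∀ j → m j ≡ occ j v) → (∀ j → m j ℕ.≤ occ j ω) →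
                     subword ω (firsts m ω) ≋ v × length (subword ω (firsts m ω)) ≡ length v
    subword-firsts m good [] legv m≡ m≤ =
      let v≡[] = occ-zero λ j → trans (sym (m≡ j)) (ℕ.n≤0⇒n≡0 (m≤ j))
      in ≋-reflexive (sym v≡[]) , cong length (sym v≡[])
    subword-firsts {c} {i ∷ ω} {v} m good (legal i∈ ci leg) legv m≡ m≤ = by-cases (extract good i∈ ci legv)
      where
      m′ : Fin n → ℕ
      m′ j = m j ∸ δ i j
      m′≤ : ∀ j → m′ j ℕ.≤ occ j ω
      m′≤ j = ℕ.m≤n+o⇒m∸n≤o (m j) (δ i j) (m≤ j)
      I = firsts m′ ω
      Goal : Bool → Set
      Goal b = subword (i ∷ ω) (b ∷ I) ≋ v × length (subword (i ∷ ω) (b ∷ I)) ≡ length v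
      by-cases : Extract c i v → Goal (positive? (m i))
      by-cases (absent occ≡0 leg′) = subst (λ k → Goal (positive? k)) (sym (trans (m≡ i) occ≡0))
        (subword-firsts m′ (good-fire good i∈ ci) leg leg′ m′≡ m′≤)
        where
        m′≡ : ∀ j → m′ j ≡ occ j v
        m′≡ j with i ≟ j
        ... | yes refl = trans (cong (_∸ 1) (trans (m≡ i) occ≡0)) (sym occ≡0)
        ... | no  _    = m≡ j
      by-cases (present v′ perm eq leg′) = subst (λ k → Goal (positive? k)) (sym mi≡)
        (≋-trans (++-congˡ [ i ] (proj₁ rec)) (≋-sym eq) , trans (cong suc (proj₂ rec)) (sym (↭-length perm)))
        where
        m≡′ : ∀ j → m j ≡ δ i j ℕ.+ occ j v′
        m≡′ j = trans (m≡ j) (occ-↭ perm j)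
        mi≡ : m i ≡ suc (occ i v′)
        mi≡ = trans (m≡′ i) (cong (ℕ._+ occ i v′) (δ-refl i))
        rec = subword-firsts m′ (good-fire good i∈ ci) leg leg′
          (λ j → trans (cong (_∸ δ i j) (m≡′ j)) (ℕ.m+n∸m≡n (δ i j) (occ j v′))) m′≤

    -- The counts guarantee that each letter of v is present in w when its turn comes. Moving it to
    -- the front leaves u in the end.
    legal-prefix : ∀ {c v w} → Good c → Legal c v → Legal c w → (∀ j → occ j v ℕ.≤ occ j w) →
                   ∃[ u ] w ≋ v ++ u × length w ≡ length v ℕ.+ length u
    legal-prefix {w = w} good [] legw occ≤ = w , ≋-refl , refl
    legal-prefix {w = w} good (legal {i} {v} i∈ ci leg) legw occ≤ = by-cases (extract good i∈ ci legw)
      where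
      by-cases : Extract _ i w → ∃[ u ] w ≋ i ∷ v ++ u × length w ≡ suc (length v) ℕ.+ length u
      by-cases (absent occ≡0 _) = contradiction (subst₂ ℕ._≤_ (cong (ℕ._+ occ i v) (δ-refl i)) occ≡0 (occ≤ i)) λ ()
      by-cases (present w′ perm eq leg′) =
        let u , eq′ , len = legal-prefix (good-fire good i∈ ci) leg leg′ λ j →
              ℕ.+-cancelˡ-≤ (δ i j) (occ j v) (occ j w′) (subst (δ i j ℕ.+ occ j v ℕ.≤_) (occ-↭ perm j) (occ≤ j))
        in u , ≋-trans eq (++-congˡ [ i ] eq′) , trans (↭-length perm) (cong suc len)

    -- The letters of v are extracted from t in turn. One that is absent can be fired in front of
    -- what remains of t, giving a longer play; hence a longest play dominates every play letter by
    -- letter.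
    occ-≤-or-extend : ∀ {c v t} → Good c → Legal c v → Legal c t →
                      (∀ j → occ j v ℕ.≤ occ j t) ⊎ ∃[ t′ ] Legal c t′ × length t′ ≡ suc (length t)
    occ-≤-or-extend good [] legt = inj₁ λ _ → z≤n
    occ-≤-or-extend {c} {t = t} good (legal {i} {v} i∈ ci leg) legt = by-cases (extract good i∈ ci legt)
      where
      by-cases : Extract c i t → (∀ j → occ j (i ∷ v) ℕ.≤ occ j t) ⊎ ∃[ t′ ] Legal c t′ × length t′ ≡ suc (length t)
      by-cases (absent _ leg′) = inj₂ (i ∷ t , legal i∈ ci leg′ , refl)
      by-cases (present t₁ perm _ leg′) with occ-≤-or-extend (good-fire good i∈ ci) leg leg′
      ... | inj₁ occ≤ = inj₁ λ j → subst (δ i j ℕ.+ occ j v ℕ.≤_) (sym (occ-↭ perm j)) (ℕ.+-monoʳ-≤ (δ i j) (occ≤ j))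
      ... | inj₂ (t′ , leg″ , len) = inj₂ (i ∷ t′ , legal i∈ ci leg″ , cong suc (trans len (sym (↭-length perm))))

    -- If the first letter i of one play were absent from w, then `i ∷ w` would be legal, hence
    -- reduced, and would represent the same element as the remaining word v; but then w would be
    -- shorter than v, while it represents the same element as the reduced word `i ∷ v`.
    occ-unique : ∀ {c v w} → Good c → Legal c v → Legal c w → v ≋ w → ∀ j → occ j v ≡ occ j w
    occ-unique {w = []}    good [] legw eq j = refl
    occ-unique {w = _ ∷ _} good [] legw eq j = contradiction (red-minimal _ _ (proj₁ (good legw)) (≋-sym eq)) λ ()
    occ-unique {c} {w = w} good legv@(legal {i} {v} i∈ ci leg) legw eq j = by-cases (extract good i∈ ci legw)
      where
      by-cases : Extract c i w → δ i j ℕ.+ occ j v ≡ occ j w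
      by-cases (present w′ perm eq′ leg′) = trans (cong (δ i j ℕ.+_)
        (occ-unique (good-fire good i∈ ci) leg leg′ (++-cancelˡ [ i ] (≋-trans eq eq′)) j)) (sym (occ-↭ perm j))
      by-cases (absent _ leg′) = contradiction
        (ℕ.≤-trans (red-minimal _ _ (proj₁ (good legv)) eq) (ℕ.≤-trans (ℕ.n≤1+n (length w))
          (red-minimal _ _ (proj₁ (good (legal i∈ ci leg′))) (≋-trans (++-congˡ [ i ] (≋-sym eq)) (cancel-double i v)))))
        (ℕ.<-irrefl refl)

-- Leftmost subwords in a minuscule quotient

0≤x≤1 : ∀ {x} → 0ℤ ≤ x → x ≤ 1ℤ → x ≢ 0ℤ → x ≡ 1ℤ
0≤x≤1 {ℤ.+ 0}             _ _              x≢0 = contradiction refl x≢0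
0≤x≤1 {ℤ.+ 1}             _ _              _   = refl
0≤x≤1 {ℤ.+ (suc (suc _))} _ (+≤+ (s≤s ())) _

module Sort {n : ℕ} (R : RootSystem n) where
  open WeylGroup R
  open Basics R

  -- I is compared with the subwords for all x ≤_R v, not only with those for v:
  -- a subword of ω ++ t for v_J · ᴶv meets ω in a subword for a prefix of v_J.
  record LeftmostPrefix (ω v : Word n) (I : Subset (length ω)) : Set where
    field
      reduced  : Reduced (subword ω I)
      word-for : subword ω I ≋ v
      leftmost : ∀ J x → Reduced (subword ω J) → subword ω J ++ x ≋ v → ℓ (subword ω J) ℕ.+ ℓ x ≡ ℓ v → I ≤lex J

module MinusculeQuotient {n : ℕ} (R : RootSystem n) (s : Fin n) (K : List (Fin n)) (s∉K : s ∉ˡ K)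
                         (minuscule : WeylGroup.Minuscule R (s ∷ K) s) where
  open RootSystem R using (roots; coroot; reflect; simple-root; positive-or-negative; reflect-root)
  open WeylGroup R
  open Basics R
  open Length R
  open Parabolic R
  open Game R (s ∷ K)
  open Sort R

  private
    L = s ∷ K

  state : Word n → State
  state w j = lookup (act w (simple j)) s

  rootOf-act : ∀ w {i} → All (_∈ˡ L) w → i ∈ˡ L → RootOf L (act w (simple i))
  rootOf-act w {i} pw i∈ = act-simple-root w i , support w pw i∈

  pairing-reflect : ∀ j γ → ⟨ reflect (simple j) γ , coroot (simple j) ⟩ ≡ - ⟨ γ , coroot (simple j) ⟩
  pairing-reflect j γ = begin
    ⟨ reflect (simple j) γ , f ⟩        ≡⟨ linear-reflect (⟨,⟩-linear f) (simple j) γ ⟩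
    ⟨ γ , f ⟩ - ⟨ γ , f ⟩ * cartan j j  ≡⟨ cong (λ x → ⟨ γ , f ⟩ - ⟨ γ , f ⟩ * x) (cartan-self j) ⟩
    ⟨ γ , f ⟩ - ⟨ γ , f ⟩ * (1ℤ + 1ℤ)   ≡⟨ double ⟨ γ , f ⟩ ⟩
    - ⟨ γ , f ⟩                         ∎
    where
    open ≡-Reasoning
    f = coroot (simple j)
    double : ∀ x → x - x * (1ℤ + 1ℤ) ≡ - x
    double = solve-∀

  pairing-reflect-≢0 : ∀ j γ → ⟨ γ , coroot (simple j) ⟩ ≢ 0ℤ → ⟨ reflect (simple j) γ , coroot (simple j) ⟩ ≢ 0ℤ
  pairing-reflect-≢0 j γ ≢0 eq = ≢0 (ℤ.neg-injective (trans (sym (pairing-reflect j γ)) eq))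

  -- If γ is not orthogonal to αⱼ, both γ and its reflection are linked to αⱼ; otherwise the
  -- reflection fixes γ.
  component-reflect : ∀ j γ → RootOf L (simple j) → RootOf L γ → RootOf L (reflect (simple j) γ) →
                      SameComponent L γ (reflect (simple j) γ)
  component-reflect j γ rootⱼ rootγ rootsγ with ⟨ γ , coroot (simple j) ⟩ ℤ.≟ 0ℤ
  ... | no  ≢0 = fwd (rootγ , rootⱼ , ≢0) ◅ bwd (rootsγ , rootⱼ , pairing-reflect-≢0 j γ ≢0) ◅ ε
  ... | yes ≡0 = subst (SameComponent L γ) (vec-ext λ k → sym (begin
    lookup (reflect (simple j) γ) k                                        ≡⟨ lookup-reflect (simple j) γ k ⟩
    lookup γ k - ⟨ γ , coroot (simple j) ⟩ * lookup (simple j) k           ≡⟨ cong (λ x → lookup γ k - x * lookup (simple j) k) ≡0 ⟩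
    lookup γ k - 0ℤ * lookup (simple j) k                                  ≡⟨ cong (λ x → lookup γ k - x) (ℤ.*-zeroˡ (lookup (simple j) k)) ⟩
    lookup γ k - 0ℤ                                                        ≡⟨ ℤ.+-identityʳ _ ⟩
    lookup γ k                                                             ∎)) ε
    where open ≡-Reasoning

  -- Applying simple reflections moves a root within its component, and only
  -- s changes the coordinate at αₛ.
  component-of-s : ∀ w {i} → All (_∈ˡ L) w → i ∈ˡ L → state w i ≢ 0ℤ → SameComponent L (simple s) (act w (simple i))
  component-of-s [] {i} [] i∈ ≢0 = subst (SameComponent L (simple s) ∘ simple)
    (decidable-stable (s ≟ i) λ s≢i → ≢0 (lookup-simple-≢ (s≢i ∘ sym))) ε
  component-of-s (j ∷ w) {i} (j∈ ∷ pw) i∈ ≢0 with state w i ℤ.≟ 0ℤ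
  ... | no  γₛ≢0 = component-of-s w pw i∈ γₛ≢0 ◅◅
    component-reflect j (act w (simple i)) (rootOf-act [] [] j∈) (rootOf-act w pw i∈) (rootOf-act (j ∷ w) (j∈ ∷ pw) i∈)
  ... | yes γₛ≡0 with j ≟ s
  ...   | no  j≢s  = contradiction (trans (lookup-reflect-≢ (act w (simple i)) j≢s) γₛ≡0) ≢0
  -- Applying s has just made the αₛ-coordinate nonzero, so the root pairs nontrivially with the
  -- coroot of αₛ and is linked to αₛ directly.
  ...   | yes refl = bwd (rootOf-act (j ∷ w) (j∈ ∷ pw) i∈ , rootOf-act [] [] j∈ , pairing-reflect-≢0 s γ pairing≢0) ◅ ε
    where
    γ = act w (simple i)
    pairing≢0 : ⟨ γ , coroot (simple s) ⟩ ≢ 0ℤ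
    pairing≢0 eq = ≢0 (trans (lookup-reflect-refl s γ) (cong₂ _-_ γₛ≡0 eq))

  cone-nonneg : ∀ {v} → Cone L v → ∀ k → 0ℤ ≤ lookup v k
  cone-nonneg zero k = ℤ.≤-reflexive (sym (Vec.lookup-replicate k 0ℤ))
  cone-nonneg (add {α} {v} (_ , α≥0) cone) k =
    subst (0ℤ ≤_) (sym (lookup-⊕ α v k)) (ℤ.+-mono-≤ (lookup⁺ α≥0 k) (cone-nonneg cone k))

  -- A positive root with nonzero αₛ-coordinate lies in the component of αₛ, hence below the maximal
  -- root θ, whose αₛ-coordinate is 1.
  state-≤1 : ∀ w {i} → All (_∈ˡ L) w → i ∈ˡ L → state w i ≤ 1ℤ
  state-≤1 w {i} pw i∈ with positive-or-negative (act-simple-root w i) | state w i ℤ.≟ 0ℤ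
  ... | inj₂ neg | _      = ℤ.≤-trans (lookup⁺ neg s) (+≤+ z≤n)
  ... | inj₁ pos | yes ≡0 = subst (_≤ 1ℤ) (sym ≡0) (+≤+ z≤n)
  ... | inj₁ pos | no  ≢0 =
    let θ , (_ , _ , maximal) , θₛ≡1 = minuscule
        γ = act w (simple i)
        cone = maximal γ (rootOf-act w pw i∈ , pos) (component-of-s w pw i∈ ≢0)
    in subst (lookup γ s ≤_) θₛ≡1 (ℤ.0≤i-j⇒j≤i (subst (0ℤ ≤_) (lookup-⊖ θ γ s) (cone-nonneg cone s)))

  state-fire : ∀ u i → state u i ≡ 1ℤ → ∀ j → fire i (state u) j ≡ state (u ++ [ i ]) j
  state-fire u i uᵢ≡1 j = sym (begin
    lookup (act (u ++ [ i ]) (simple j)) s             ≡⟨ cong (λ x → lookup x s) (act-++ u [ i ] (simple j)) ⟩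
    lookup (act u (reflect (simple i) (simple j))) s   ≡⟨ linear-reflect (act-linear u (lookup-linear s)) (simple i) (simple j) ⟩
    state u j - cartan j i * state u i                 ≡⟨ cong (λ x → state u j - cartan j i * x) uᵢ≡1 ⟩
    state u j - cartan j i * 1ℤ                        ≡⟨ cong (λ x → state u j - x) (ℤ.*-identityʳ (cartan j i)) ⟩
    state u j - cartan j i                             ∎)
    where open ≡-Reasoning

  fire-step : ∀ {c} u i → (∀ j → c j ≡ state u j) → c i ≡ 1ℤ → ∀ j → fire i c j ≡ state (u ++ [ i ]) j
  fire-step u i c≗ cᵢ≡1 j = trans (cong (_- cartan j i) (c≗ j)) (state-fire u i (trans (sym (c≗ i)) cᵢ≡1) j)

  final-state : ∀ {c w} u → (∀ j → c j ≡ state u j) → Legal c w → ∀ j → final c w j ≡ state (u ++ w) j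
  final-state u c≗ [] j = trans (c≗ j) (cong (λ x → state x j) (sym (List.++-identityʳ u)))
  final-state u c≗ (legal {i} {w} i∈ cᵢ≡1 leg) j = trans (final-state (u ++ [ i ]) (fire-step u i c≗ cᵢ≡1) leg j)
    (cong (λ x → state x j) (List.++-assoc u [ i ] w))

  -- `MinRep` concerns a group element; this is the corresponding property of a word, which is what
  -- a play can be compared with.
  record Minimal (w : Word n) : Set where
    constructor minimal
    field
      letters  : All (_∈ˡ L) w
      reduced  : Reduced w
      shortest : Shortest K w

  open Minimal

  -- If the inverse of u sᵢ made αⱼ negative, then u⁻¹αⱼ = αᵢ. So u αᵢ would be αⱼ, whose
  -- αₛ-coordinate is 0 because s is not in K.
  shortest-∷ʳ : ∀ u i → Shortest K u → state u i ≡ 1ℤ → Shortest K (u ++ [ i ])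
  shortest-∷ʳ u i short uᵢ≡1 {j} j∈ = [ (λ pos → pos) , (λ neg → contradiction (negative⇒0≡1 neg) λ ()) ]′
    (positive-or-negative (act-simple-root (reverse (u ++ [ i ])) j))
    where
    open ≡-Reasoning
    γ = act (reverse u) (simple j)
    negative⇒0≡1 : Nonpos (act (reverse (u ++ [ i ])) (simple j)) → 0ℤ ≡ 1ℤ
    negative⇒0≡1 neg = begin
      0ℤ                         ≡⟨ lookup-simple-≢ {i = j} {s} (λ { refl → s∉K j∈ }) ⟨
      lookup (simple j) s        ≡⟨ cong (λ x → lookup x s) (act-reverse′ u (simple j)) ⟨
      lookup (act u γ) s         ≡⟨ cong (λ x → lookup (act u x) s) (positive-made-negative i (act-simple-root (reverse u) j)
                                      (short j∈) (subst Nonpos (act-reverse-++ u [ i ] (simple j)) neg)) ⟩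
      state u i                  ≡⟨ uᵢ≡1 ⟩
      1ℤ                         ∎

  -- The value 1 at i makes u αᵢ positive, so the length grows, and `shortest-∷ʳ` handles the coset.
  -- The word u already played is carried along because c is only its state.
  legal⇒minimal : ∀ {c w} u → (∀ j → c j ≡ state u j) → Minimal u → Legal c w → Minimal (u ++ w)
  legal⇒minimal u c≗ min [] = subst Minimal (sym (List.++-identityʳ u)) min
  legal⇒minimal u c≗ (minimal pu red short) (legal {i} {w} i∈ cᵢ≡1 leg) = subst Minimal (List.++-assoc u [ i ] w)
    (legal⇒minimal (u ++ [ i ]) (fire-step u i c≗ cᵢ≡1) (minimal (All.++⁺ pu (i∈ ∷ []))
      (reduced-∷ʳ u i red (positive-coordinate s (act-simple-root u i) uᵢ≡1)) (λ {j} → shortest-∷ʳ u i short uᵢ≡1 {j})) leg)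
    where
    uᵢ≡1 : state u i ≡ 1ℤ
    uᵢ≡1 = trans (sym (c≗ i)) cᵢ≡1

  -- A letter j of K that shortened u would shorten u w as well.
  shortest-prefix : ∀ u w → Reduced (u ++ w) → Shortest K (u ++ w) → Shortest K u
  shortest-prefix u w red short {j} j∈ with positive-or-negative (act-simple-root (reverse u) j)
  ... | inj₁ pos = pos
  ... | inj₂ neg = contradiction (begin
    suc (suc (length (u ++ w)))       ≡⟨ cong (λ k → suc (suc k)) red ⟩
    suc (suc (ℓ (u ++ w)))            ≡⟨ cong suc (ℓ-upˡ j (u ++ w) (short j∈)) ⟨
    suc (ℓ (j ∷ u ++ w))              ≤⟨ s≤s (ℓ-++-≤ (j ∷ u) w) ⟩
    suc (ℓ (j ∷ u)) ℕ.+ ℓ w           ≡⟨ cong (ℕ._+ ℓ w) (ℓ-downˡ j u neg) ⟩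
    ℓ u ℕ.+ ℓ w                       ≤⟨ ℕ.+-mono-≤ (ℓ-≤-self u) (ℓ-≤-self w) ⟩
    length u ℕ.+ length w             ≡⟨ List.length-++ u ⟨
    length (u ++ w)                   ∎) (ℕ.<⇒≱ (s≤s (ℕ.n≤1+n (length (u ++ w)))))
    where open ℕ.≤-Reasoning

  minimal-prefix : ∀ u w → Minimal (u ++ w) → Minimal u
  minimal-prefix u w (minimal pw red short) =
    minimal (All.++⁻ˡ u pw) (proj₁ (reduced-++ u w red)) (λ {j} → shortest-prefix u w red short {j})

  -- With αₛ-coordinate 0, the positive root u αᵢ would be a root of W_K, so the inverse of u sᵢ
  -- would keep it positive; but it is sent to -αᵢ. Minuscularity turns nonzero into 1.
  minimal-∷ʳ-state : ∀ u i → Minimal (u ++ [ i ]) → state u i ≡ 1ℤ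
  minimal-∷ʳ-state u i min = 0≤x≤1 (lookup⁺ γ≥0 s) (state-≤1 u pu i∈) λ uᵢ≡0 →
    contradiction (subst (0ℤ ≤_) value (lookup⁺ (shortest-nonneg (u ++ [ i ]) (shortest min) γ≥0 (in-K uᵢ≡0)) i)) λ ()
    where
    open ≡-Reasoning
    γ = act u (simple i)
    γ≥0 : Nonneg γ
    γ≥0 = reduced-∷ʳ-nonneg u i (reduced min)
    pu = All.++⁻ˡ u (letters min)
    i∈ : i ∈ˡ L
    i∈ = All.head (All.++⁻ʳ u (letters min))
    in-K : state u i ≡ 0ℤ → ∀ k → k ∉ˡ K → lookup γ k ≡ 0ℤ
    in-K uᵢ≡0 k k∉ with k ≟ s
    ... | yes refl = uᵢ≡0
    ... | no  k≢s  = support u pu i∈ k λ { (here k≡s) → k≢s k≡s ; (there k∈) → k∉ k∈ }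
    value : lookup (act (reverse (u ++ [ i ])) γ) i ≡ -1ℤ
    value = begin
      lookup (act (reverse (u ++ [ i ])) γ) i              ≡⟨ cong (λ x → lookup x i) (act-reverse-++ u [ i ] γ) ⟩
      lookup (reflect (simple i) (act (reverse u) γ)) i    ≡⟨ cong (λ x → lookup (reflect (simple i) x) i) (act-reverse u (simple i)) ⟩
      lookup (reflect (simple i) (simple i)) i             ≡⟨ linear-neg-simple (lookup-linear i) i ⟩
      - lookup (simple i) i                                ≡⟨ cong -_ (lookup-simple-refl i) ⟩
      -1ℤ                                                  ∎

  minimal⇒legal : ∀ {c} u w → (∀ j → c j ≡ state u j) → Minimal (u ++ w) → Legal c w
  minimal⇒legal u []      c≗ min = []
  minimal⇒legal u (i ∷ w) c≗ min = legal (All.head (All.++⁻ʳ u (letters min))) cᵢ≡1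
    (minimal⇒legal (u ++ [ i ]) w (fire-step u i c≗ cᵢ≡1) min′)
    where
    min′ : Minimal ((u ++ [ i ]) ++ w)
    min′ = subst Minimal (sym (List.++-assoc u [ i ] w)) min
    cᵢ≡1 = trans (c≗ i) (minimal-∷ʳ-state u i (minimal-prefix (u ++ [ i ]) w min′))

  -- The opening position has 1 at s and 0 elsewhere, so s is the only possible first move.
  c₀ : State
  c₀ = state []

  minimal-[] : Minimal []
  minimal-[] = minimal [] (sym ℓ-[]) λ {j} _ → lookup⁻ (lookup-simple-nonneg j)

  minimal-legal : ∀ {w} → Minimal w → Legal c₀ w
  minimal-legal {w} min = minimal⇒legal [] w (λ _ → refl) min

  legal-minimal : ∀ {w} → Legal c₀ w → Minimal w
  legal-minimal leg = legal⇒minimal [] (λ _ → refl) minimal-[] leg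

  reduced-minimal : ∀ u v → Reduced u → u ≋ v → length u ℕ.≤ length v
  reduced-minimal u v red u≋v = ℕ.≤-trans (ℕ.≤-reflexive (trans red (ℓ-cong u≋v))) (ℓ-≤-self v)

  reduced-suffix : ∀ i w → Reduced (i ∷ w) → Reduced w
  reduced-suffix i w red = proj₂ (reduced-++ [ i ] w red)

  open Bounded Reduced reduced-suffix reduced-minimal

  good : Good c₀
  good {w} leg = reduced (legal-minimal leg) , λ {i} i∈ →
    subst (_≤ 1ℤ) (sym (final-state [] (λ _ → refl) leg i)) (state-≤1 w (letters (legal-minimal leg)) i∈)

  minRep-reduced-word : ∀ v w → MinRep K L v → Reduced w → w ≋ v → Minimal w
  minRep-reduced-word v w min@(v∈ , _) red w≋v = minimal
    (∈W-letters w (∈W-resp (≋-sym w≋v) v∈) red) red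
    (λ {j} → shortest-resp (≋-sym w≋v) (λ {k} → minRep⇒shortest v min {k}) {j})

  minimal-minRep : ∀ {x} → Minimal x → MinRep K L x
  minimal-minRep {x} min = shortest⇒minRep x (letters-∈W (letters min)) (shortest min)

  module _ (t : Word n) (t-reduced : Reduced t) (top : TopMinRep K L t) where

    private
      t-legal : Legal c₀ t
      t-legal = minimal-legal (minRep-reduced-word t t (proj₁ top) t-reduced ≋-refl)

    -- An extension of t would be a minimal representative longer than the top one.
    occ-≤-top : ∀ {x} → Legal c₀ x → ∀ j → occ j x ℕ.≤ occ j t
    occ-≤-top leg = [ (λ occ≤ → occ≤) , (λ ext → contradiction ext no-extension) ]′ (occ-≤-or-extend good leg t-legal)
      where
      open ℕ.≤-Reasoning
      no-extension : ¬ (∃[ t′ ] Legal c₀ t′ × length t′ ≡ suc (length t))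
      no-extension (t′ , leg′ , len) = ℕ.<⇒≱ (begin
        suc (ℓ t)       ≡⟨ cong suc t-reduced ⟨
        suc (length t)  ≡⟨ len ⟨
        length t′       ≡⟨ reduced (legal-minimal leg′) ⟩
        ℓ t′            ∎) (proj₂ top t′ (minimal-minRep (legal-minimal leg′)))

    quotientSort : ∀ v → MinRep K L v → Subset (length t)
    quotientSort v _ = firsts (λ j → occ j (proj₁ (reduced-word v))) t

    private
      word : Word n → Word n
      word v = proj₁ (reduced-word v)

      word≋ : ∀ v → word v ≋ v
      word≋ v = proj₂ (proj₂ (reduced-word v))

      word-reduced : ∀ v → Reduced (word v)
      word-reduced v = proj₁ (proj₂ (reduced-word v))

      word-legal : ∀ v → MinRep K L v → Legal c₀ (word v)
      word-legal v min = minimal-legal (minRep-reduced-word v (word v) min (word-reduced v) (word≋ v))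

      prefix-occ : ∀ v → MinRep K L v → ∀ y x → Reduced y → y ++ x ≋ v → ℓ y ℕ.+ ℓ x ≡ ℓ v →
                   ∀ j → occ j y ℕ.≤ occ j (word v)
      prefix-occ v min y x red yx≋v len j = subst (occ j y ℕ.≤_)
        (trans (sym (occ-++ y (word x) j)) (occ-unique good legal-yx (word-legal v min) (≋-trans yx′≋v (≋-sym (word≋ v))) j))
        (ℕ.m≤m+n (occ j y) (occ j (word x)))
        where
        open ≡-Reasoning
        yx′≋v : y ++ word x ≋ v
        yx′≋v = ≋-trans (++-congˡ y (word≋ x)) yx≋v
        yx′-reduced : Reduced (y ++ word x)
        yx′-reduced = begin
          length (y ++ word x)          ≡⟨ List.length-++ y ⟩
          length y ℕ.+ length (word x)  ≡⟨ cong₂ ℕ._+_ red (word-reduced x) ⟩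
          ℓ y ℕ.+ ℓ (word x)            ≡⟨ cong (ℓ y ℕ.+_) (ℓ-cong (word≋ x)) ⟩
          ℓ y ℕ.+ ℓ x                   ≡⟨ len ⟩
          ℓ v                           ≡⟨ ℓ-cong yx′≋v ⟨
          ℓ (y ++ word x)               ∎
        legal-yx : Legal c₀ (y ++ word x)
        legal-yx = minimal-legal (minRep-reduced-word v (y ++ word x) min yx′-reduced yx′≋v)

    quotientSort-leftmost : ∀ v min → LeftmostPrefix t v (quotientSort v min)
    quotientSort-leftmost v min = record
      { reduced  = begin
          length (subword t I)  ≡⟨ proj₂ spells ⟩
          length (word v)       ≡⟨ word-reduced v ⟩
          ℓ (word v)            ≡⟨ ℓ-cong (proj₁ spells) ⟨
          ℓ (subword t I)       ∎
      ; word-for = ≋-trans (proj₁ spells) (word≋ v)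
      ; leftmost = λ J x red eq len → firsts-least t J (prefix-occ v min (subword t J) x red eq len)
      }
      where
      open ≡-Reasoning
      I = quotientSort v min
      spells : subword t I ≋ word v × length (subword t I) ≡ length (word v)
      spells = subword-firsts _ good t-legal (word-legal v min) (λ _ → refl) (occ-≤-top (word-legal v min))

    quotientSort-mono : ∀ v w minᵥ min𝓌 → v ≤R w → quotientSort v minᵥ ⊆ quotientSort w min𝓌
    quotientSort-mono v w minᵥ min𝓌 (u , vu≈w , len) = firsts-mono t
      (prefix-occ w min𝓌 (word v) u (word-reduced v) (≋-trans (++-congʳ u (word≋ v)) ⌜ vu≈w ⌝)
        (trans (cong (ℕ._+ ℓ u) (ℓ-cong (word≋ v))) len))

    -- No count exceeds that of t, so counts can be read off from the sets, and `legal-prefix` turns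
    -- their comparison into a factorization with lengths adding.
    quotientSort-mono⁻ : ∀ v w minᵥ min𝓌 → quotientSort v minᵥ ⊆ quotientSort w min𝓌 → v ≤R w
    quotientSort-mono⁻ v w minᵥ min𝓌 sub = u , ⌞ vu≋w ⌟ , ℕ.≤-antisym ℓ≤ (subst (ℕ._≤ ℓ v ℕ.+ ℓ u) (ℓ-cong vu≋w) (ℓ-++-≤ v u))
      where
      prefix = legal-prefix good (word-legal v minᵥ) (word-legal w min𝓌)
        (firsts-⊆⁻ t (occ-≤-top (word-legal v minᵥ)) sub)
      u = proj₁ prefix
      vu≋w : v ++ u ≋ w
      vu≋w = begin
        v ++ u         ≈⟨ ++-congʳ u (word≋ v) ⟨
        word v ++ u    ≈⟨ proj₁ (proj₂ prefix) ⟨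
        word w         ≈⟨ word≋ w ⟩
        w              ∎
        where open ≋-Reasoning
      ℓ≤ : ℓ v ℕ.+ ℓ u ℕ.≤ ℓ w
      ℓ≤ = begin
        ℓ v ℕ.+ ℓ u                  ≡⟨ cong (ℕ._+ ℓ u) (trans (word-reduced v) (ℓ-cong (word≋ v))) ⟨
        length (word v) ℕ.+ ℓ u      ≤⟨ ℕ.+-monoʳ-≤ (length (word v)) (ℓ-≤-self u) ⟩
        length (word v) ℕ.+ length u ≡⟨ proj₂ (proj₂ prefix) ⟨
        length (word w)              ≡⟨ trans (word-reduced w) (ℓ-cong (word≋ w)) ⟩
        ℓ w                          ∎
        where open ℕ.≤-Reasoning

-- Subsets of the positions of a concatenation

append : ∀ {n} (ω ω′ : Word n) → Subset (length ω) → Subset (length ω′) → Subset (length (ω ++ ω′))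
append []      ω′ []      J = J
append (_ ∷ ω) ω′ (b ∷ I) J = b ∷ append ω ω′ I J

data Split {n} (ω ω′ : Word n) : Subset (length (ω ++ ω′)) → Set where
  split : ∀ I J → Split ω ω′ (append ω ω′ I J)

splitAppend : ∀ {n} (ω ω′ : Word n) (I : Subset (length (ω ++ ω′))) → Split ω ω′ I
splitAppend []      ω′ J       = split [] J
splitAppend (_ ∷ ω) ω′ (b ∷ I) with splitAppend ω ω′ I
... | split I₁ J = split (b ∷ I₁) J

subword-append : ∀ {n} (ω ω′ : Word n) I J → subword (ω ++ ω′) (append ω ω′ I J) ≡ subword ω I ++ subword ω′ J
subword-append []      ω′ []            J = refl
subword-append (i ∷ ω) ω′ (inside  ∷ I) J = cong (i ∷_) (subword-append ω ω′ I J)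
subword-append (i ∷ ω) ω′ (outside ∷ I) J = subword-append ω ω′ I J

All-subword : ∀ {n} {P : Fin n → Set} {ω : Word n} → All P ω → ∀ I → All P (subword ω I)
All-subword []       []            = []
All-subword (p ∷ ps) (inside  ∷ I) = p ∷ All-subword ps I
All-subword (p ∷ ps) (outside ∷ I) = All-subword ps I

append-≤lex : ∀ {n} (ω ω′ : Word n) {I I′ J J′} →
              I ≤lex I′ → (I ≡ I′ → J ≤lex J′) → append ω ω′ I J ≤lex append ω ω′ I′ J′
append-≤lex []      ω′ {[]}    {[]}     _                J≤ = J≤ refl
append-≤lex (_ ∷ ω) ω′ {_ ∷ _} {_ ∷ _} (this b≺b′ _)    J≤ = this b≺b′ refl
append-≤lex (_ ∷ ω) ω′ {_ ∷ _} {_ ∷ _} (next refl I≤I′) J≤ = next refl (append-≤lex ω ω′ I≤I′ λ { refl → J≤ refl })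

append-⊆ : ∀ {n} (ω ω′ : Word n) {I I′ J J′} → I ⊆ I′ → J ⊆ J′ → append ω ω′ I J ⊆ append ω ω′ I′ J′
append-⊆ []      ω′ {[]}    {[]}    I⊆ J⊆ x∈         = J⊆ x∈
append-⊆ (_ ∷ ω) ω′ {_ ∷ _} {_ ∷ _} I⊆ J⊆ here       with I⊆ here
... | here = here
append-⊆ (_ ∷ ω) ω′ {_ ∷ _} {_ ∷ _} I⊆ J⊆ (there x∈) = there (append-⊆ ω ω′ (drop-∷-⊆ I⊆) J⊆ x∈)

append-⊆⁻ : ∀ {n} (ω ω′ : Word n) {I I′ J J′} → append ω ω′ I J ⊆ append ω ω′ I′ J′ → I ⊆ I′ × J ⊆ J′
append-⊆⁻ []      ω′ {[]}    {[]}     sub = (λ ()) , sub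
append-⊆⁻ (_ ∷ ω) ω′ {b ∷ I} {b′ ∷ I′} sub = ⊆-cons , proj₂ rest
  where
  rest = append-⊆⁻ ω ω′ (drop-∷-⊆ sub)
  ⊆-cons : b ∷ I ⊆ b′ ∷ I′
  ⊆-cons here with sub here
  ... | here = here
  ⊆-cons (there x∈) = there (proj₁ rest x∈)

≤lex-antisym : ∀ {N} {I J : Subset N} → I ≤lex J → J ≤lex I → I ≡ J
≤lex-antisym I≤J J≤I = Pointwise-≡⇒≡ (Lex.antisym sym (λ eq lt → Bool.<-irrefl (sym eq) lt) (λ lt gt → Bool.<-asym lt gt) I≤J J≤I)

-- Sorting a product, and the induction along the minuscule sequence

module SortingOrders {n : ℕ} (R : RootSystem n) where
  open WeylGroup R
  open Basics R
  open Length R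
  open Parabolic R
  open Sort R
  open LeftmostPrefix

  -- The instance x = [] of the stronger property carried by the induction.
  leftmost-isSort : ∀ {ω v I} → LeftmostPrefix ω v I → IsSort ω v I
  leftmost-isSort {ω} {v} {I} I-left = (reduced I-left , ⌞ word-for I-left ⌟) , λ J → λ { (red , eq) → leftmost I-left J [] red
    (≋-trans (≋-reflexive (List.++-identityʳ (subword ω J))) (⌜_⌝ {subword ω J} {v} eq))
    (trans (cong (ℓ (subword ω J) ℕ.+_) ℓ-[]) (trans (ℕ.+-identityʳ _) (ℓ-cong (⌜_⌝ {subword ω J} {v} eq)))) }

  isSort-unique : ∀ {ω v I J} → IsSort ω v I → IsSort ω v J → I ≡ J
  isSort-unique {I = I} {J} (I-word , I-least) (J-word , J-least) = ≤lex-antisym (I-least J J-word) (J-least I I-word)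

  leftmost-unique : ∀ {ω v I J} → LeftmostPrefix ω v I → LeftmostPrefix ω v J → I ≡ J
  leftmost-unique {ω} {v} I-left J-left = isSort-unique {ω} {v} (leftmost-isSort I-left) (leftmost-isSort J-left)

  leftmost-resp : ∀ {ω v w I} → v ≋ w → LeftmostPrefix ω v I → LeftmostPrefix ω w I
  leftmost-resp v≋w I-left = record
    { reduced  = reduced I-left
    ; word-for = ≋-trans (word-for I-left) v≋w
    ; leftmost = λ J x red eq len → leftmost I-left J x red (≋-trans eq (≋-sym v≋w)) (trans len (sym (ℓ-cong v≋w)))
    }

  -- A competing subword is y z with y from ω and z from t. Factoring z x as p′ q′ over K,
  -- uniqueness gives y p′ = p and q′ = q, so y is a prefix of p and the hypothesis on I applies. If
  -- I = I′ then y = p and z x = q, and the hypothesis on J applies.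
  leftmost-append : ∀ {s K ω t p q I J} → All (_∈ˡ K) ω → p ∈W K → q ∈W (s ∷ K) → Shortest K q →
                    LeftmostPrefix ω p I → LeftmostPrefix t q J → LeftmostPrefix (ω ++ t) (p ++ q) (append ω t I J)
  leftmost-append {s} {K} {ω} {t} {p} {q} {I} {J} ω-letters p∈ q∈ short I-left J-left = record
    { reduced = subst Reduced (sym word≡) (begin
        length (a ++ b)        ≡⟨ List.length-++ a ⟩
        length a ℕ.+ length b  ≡⟨ cong₂ ℕ._+_ (reduced I-left) (reduced J-left) ⟩
        ℓ a ℕ.+ ℓ b            ≡⟨ cong₂ ℕ._+_ (ℓ-cong (word-for I-left)) (ℓ-cong (word-for J-left)) ⟩
        ℓ p ℕ.+ ℓ q            ≡⟨ ℓ-++ p q p∈ short ⟨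
        ℓ (p ++ q)             ≡⟨ ℓ-cong (++-cong (word-for I-left) (word-for J-left)) ⟨
        ℓ (a ++ b)             ∎)
    ; word-for = ≋-trans (≋-reflexive word≡) (++-cong (word-for I-left) (word-for J-left))
    ; leftmost = λ M x red eq len → compare M x red eq len (splitAppend ω t M)
    }
    where
    open ≡-Reasoning
    a = subword ω I
    b = subword t J
    word≡ : subword (ω ++ t) (append ω t I J) ≡ a ++ b
    word≡ = subword-append ω t I J

    compare : ∀ M x → Reduced (subword (ω ++ t) M) → subword (ω ++ t) M ++ x ≋ p ++ q →
              ℓ (subword (ω ++ t) M) ℕ.+ ℓ x ≡ ℓ (p ++ q) → Split ω t M → append ω t I J ≤lex M
    compare _ x red eq len (split I′ J′) = append-≤lex ω t I≤I′ J≤J′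
      where
      y = subword ω I′
      z = subword t J′
      r = z ++ x

      yz≡ : subword (ω ++ t) (append ω t I′ J′) ≡ y ++ z
      yz≡ = subword-append ω t I′ J′

      yz-reduced : Reduced (y ++ z)
      yz-reduced = subst Reduced yz≡ red

      y-reduced : Reduced y
      y-reduced = proj₁ (reduced-++ y z yz-reduced)

      z-reduced : Reduced z
      z-reduced = proj₂ (reduced-++ y z yz-reduced)

      y∈ : y ∈W K
      y∈ = letters-∈W (All-subword ω-letters I′)

      yr≋ : y ++ r ≋ p ++ q
      yr≋ = ≋-trans (≋-reflexive (trans (sym (List.++-assoc y z x)) (cong (_++ x) (sym yz≡)))) eq

      ℓyzx : ℓ y ℕ.+ (ℓ z ℕ.+ ℓ x) ≡ ℓ p ℕ.+ ℓ q
      ℓyzx = begin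
        ℓ y ℕ.+ (ℓ z ℕ.+ ℓ x)          ≡⟨ ℕ.+-assoc (ℓ y) (ℓ z) (ℓ x) ⟨
        ℓ y ℕ.+ ℓ z ℕ.+ ℓ x            ≡⟨ cong (ℕ._+ ℓ x) (cong₂ ℕ._+_ y-reduced z-reduced) ⟨
        length y ℕ.+ length z ℕ.+ ℓ x  ≡⟨ cong (ℕ._+ ℓ x) (List.length-++ y) ⟨
        length (y ++ z) ℕ.+ ℓ x        ≡⟨ cong (ℕ._+ ℓ x) yz-reduced ⟩
        ℓ (y ++ z) ℕ.+ ℓ x             ≡⟨ cong (λ w → ℓ w ℕ.+ ℓ x) yz≡ ⟨
        ℓ (subword (ω ++ t) (append ω t I′ J′)) ℕ.+ ℓ x ≡⟨ len ⟩
        ℓ (p ++ q)                     ≡⟨ ℓ-++ p q p∈ short ⟩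
        ℓ p ℕ.+ ℓ q                    ∎

      -- Subadditivity gives both inequalities: for z x in one direction, for y r in the other.
      ℓyr : ℓ y ℕ.+ ℓ r ≡ ℓ p ℕ.+ ℓ q
      ℓyr = ℕ.≤-antisym
        (subst (ℓ y ℕ.+ ℓ r ℕ.≤_) ℓyzx (ℕ.+-monoʳ-≤ (ℓ y) (ℓ-++-≤ z x)))
        (subst (ℕ._≤ ℓ y ℕ.+ ℓ r) (trans (ℓ-cong yr≋) (ℓ-++ p q p∈ short)) (ℓ-++-≤ y r))

      r∈ : r ∈W (s ∷ K)
      r∈ = ∈W-resp r′≋r (∈W-++ (reverse y) (p ++ q) (∈W-reverse y (∈W-there y y∈)) (∈W-++ p q (∈W-there p p∈) q∈))
        where
        r′≋r : reverse y ++ (p ++ q) ≋ r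
        r′≋r = ≋.begin
          reverse y ++ (p ++ q)   ≋.≈⟨ ++-congˡ (reverse y) yr≋ ⟨
          reverse y ++ (y ++ r)   ≋.≡⟨ List.++-assoc (reverse y) y r ⟨
          (reverse y ++ y) ++ r   ≋.≈⟨ ++-congʳ r (inverseˡ y) ⟩
          r                       ≋.∎
          where module ≋ = ≋-Reasoning

      I≤I′ : I ≤lex I′
      I≤I′ =
        let r₁ , r₁-letters , _ , r₁≋r = ∈W-reduced-word r r∈
            p′ , q′ , p′-letters , _ , short′ , p′q′≋r₁ = factor r₁ r₁-letters
            p′q′≋r = ≋-trans p′q′≋r₁ r₁≋r
            p′∈ = letters-∈W p′-letters
            yp′≋p , q′≋q = factor-unique (y ++ p′) q′ p q (∈W-++ y p′ y∈ p′∈) p∈ (λ {j} → short′ {j}) (λ {j} → short {j})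
              (≋-trans (≋-reflexive (List.++-assoc y p′ q′)) (≋-trans (++-congˡ y p′q′≋r) yr≋))
            ℓr = trans (sym (ℓ-cong p′q′≋r)) (trans (ℓ-++ p′ q′ p′∈ short′) (cong (ℓ p′ ℕ.+_) (ℓ-cong q′≋q)))
        in leftmost I-left I′ p′ y-reduced yp′≋p
          (ℕ.+-cancelʳ-≡ (ℓ q) _ _ (trans (ℕ.+-assoc (ℓ y) (ℓ p′) (ℓ q)) (trans (cong (ℓ y ℕ.+_) (sym ℓr)) ℓyr)))

      J≤J′ : I ≡ I′ → J ≤lex J′
      J≤J′ I≡I′ = leftmost J-left J′ x z-reduced
        (++-cancelˡ p (≋-trans (++-congʳ r (≋-sym y≋p)) yr≋))
        (ℕ.+-cancelˡ-≡ (ℓ p) _ _ (trans (cong (ℕ._+ (ℓ z ℕ.+ ℓ x)) (sym (ℓ-cong y≋p))) ℓyzx))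
        where
        y≋p : y ≋ p
        y≋p = subst (λ M → subword ω M ≋ p) I≡I′ (word-for I-left)

  -- The induction invariant. `letters` places the subwords of ω in W_K, as gluing requires, and
  -- `order` quantifies over all leftmost sets so as not to depend on how they were found.
  record Sorted (K : List (Fin n)) (ω : Word n) : Set where
    field
      letters   : All (_∈ˡ K) ω
      ω-reduced : Reduced ω
      longest   : ∀ v → v ∈W K → ℓ v ℕ.≤ ℓ ω
      sort      : ∀ v → v ∈W K → ∃[ I ] LeftmostPrefix ω v I
      order     : ∀ v w {I J} → v ∈W K → w ∈W K → LeftmostPrefix ω v I → LeftmostPrefix ω w J →
                  MiddleOrder K v w ⇔ I ⊆ J

  open Sorted

  sorted-[] : Sorted [] []
  sorted-[] = record
    { letters   = []
    ; ω-reduced = sym ℓ-[]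
    ; longest   = λ v v∈ → ℕ.≤-reflexive (ℓ-cong (≋[] v v∈))
    ; sort      = λ v v∈ → [] , record
        { reduced = sym ℓ-[] ; word-for = ≋-sym (≋[] v v∈) ; leftmost = λ { [] _ _ _ _ → base tt } }
    ; order     = λ { v w {[]} {[]} v∈ w∈ _ _ → mk⇔ (λ _ ()) (λ _ → ⌞ ≋-trans (≋[] v v∈) (≋-sym (≋[] w w∈)) ⌟) }
    }
    where
    ≋[] : ∀ v → v ∈W [] → v ≋ []
    ≋[] v ([] , [] , []≈v) = ≋-sym (⌜_⌝ {[]} {v} []≈v)

  module _ {s K ω t} (s∉K : s ∉ˡ K) (minuscule : Minuscule (s ∷ K) s) (sorted : Sorted K ω)
           (t-reduced : Reduced t) (top : TopMinRep K (s ∷ K) t) where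
    open MinusculeQuotient R s K s∉K minuscule using (quotientSort; quotientSort-leftmost; quotientSort-mono; quotientSort-mono⁻)

    private
      t∈ = proj₁ (proj₁ top)
      ω∈ = letters-∈W (letters sorted)
      t-shortest : Shortest K t
      t-shortest {j} = minRep⇒shortest t (proj₁ top) {j}

      -- Common form for the factorizations supplied by a proof of `MiddleOrder` and those computed
      -- by `factor`, so that `order-factors` serves both directions.
      record Factorization (v : Word n) : Set where
        constructor factors
        field
          {p q}  : Word n
          p∈     : p ∈W K
          q-min  : MinRep K (s ∷ K) q
          pq≋v   : p ++ q ≋ v

      open Factorization

      factorize : ∀ v → v ∈W (s ∷ K) → Factorization v
      factorize v v∈ =
        let x , x-letters , _ , x≋v = ∈W-reduced-word v v∈
            p , q , p-letters , q-letters , short , pq≋x = factor x x-letters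
        in factors {p = p} {q} (letters-∈W p-letters) (shortest⇒minRep q (letters-∈W q-letters) short) (≋-trans pq≋x x≋v)

      module _ {v} (f : Factorization v) where
        sort₁ : Subset (length ω)
        sort₁ = proj₁ (sort sorted (p f) (p∈ f))

        sort₂ : Subset (length t)
        sort₂ = quotientSort t t-reduced top (q f) (q-min f)

        sort-factors : LeftmostPrefix (ω ++ t) v (append ω t sort₁ sort₂)
        sort-factors = leftmost-resp (pq≋v f) (leftmost-append (letters sorted) (p∈ f) (proj₁ (q-min f)) (minRep⇒shortest (q f) (q-min f))
          (proj₂ (sort sorted (p f) (p∈ f))) (quotientSort-leftmost t t-reduced top (q f) (q-min f)))

      order-factors : ∀ {v w} (f : Factorization v) (g : Factorization w) →
        (MiddleOrder K (p f) (p g) × q f ≤R q g) ⇔ (append ω t (sort₁ f) (sort₂ f) ⊆ append ω t (sort₁ g) (sort₂ g))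
      order-factors {v} {w} f g = mk⇔ to from
        where
        to : MiddleOrder K (p f) (p g) × q f ≤R q g → append ω t (sort₁ f) (sort₂ f) ⊆ append ω t (sort₁ g) (sort₂ g)
        from : append ω t (sort₁ f) (sort₂ f) ⊆ append ω t (sort₁ g) (sort₂ g) → MiddleOrder K (p f) (p g) × q f ≤R q g
        middle : MiddleOrder K (p f) (p g) ⇔ sort₁ f ⊆ sort₁ g
        middle = order sorted (p f) (p g) (p∈ f) (p∈ g) (proj₂ (sort sorted (p f) (p∈ f))) (proj₂ (sort sorted (p g) (p∈ g)))
        to (mo , le) = append-⊆ ω t (Equivalence.to middle mo) (quotientSort-mono t t-reduced top (q f) (q g) (q-min f) (q-min g) le)
        from sub =
          let sub₁ , sub₂ = append-⊆⁻ ω t {sort₁ f} {sort₁ g} {sort₂ f} {sort₂ g} sub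
          in Equivalence.from middle sub₁ , quotientSort-mono⁻ t t-reduced top (q f) (q g) (q-min f) (q-min g) sub₂

      -- Factorizations consist of words and are not unique as such; but each of them yields a
      -- leftmost set for v, and that set is unique.
      order-step : ∀ v w {I J} → v ∈W (s ∷ K) → w ∈W (s ∷ K) → LeftmostPrefix (ω ++ t) v I → LeftmostPrefix (ω ++ t) w J →
                   MiddleOrder (s ∷ K) v w ⇔ I ⊆ J
      order-step v w {I} {J} v∈ w∈ I-left J-left = mk⇔ to from
        where
        to : MiddleOrder (s ∷ K) v w → I ⊆ J
        to (vJ , Jv , wJ , Jw , (vJ∈ , Jv-min , eqᵥ) , (wJ∈ , Jw-min , eq𝓌) , mo , le) =
          let f = factors {p = vJ} {Jv} vJ∈ Jv-min ⌜ eqᵥ ⌝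
              g = factors {p = wJ} {Jw} wJ∈ Jw-min ⌜ eq𝓌 ⌝
          in subst₂ _⊆_ (leftmost-unique (sort-factors f) I-left) (leftmost-unique (sort-factors g) J-left)
            (Equivalence.to (order-factors f g) (mo , le))
        from : I ⊆ J → MiddleOrder (s ∷ K) v w
        from sub =
          let f = factorize v v∈
              g = factorize w w∈
              mo , le = Equivalence.from (order-factors f g)
                (subst₂ _⊆_ (leftmost-unique I-left (sort-factors f)) (leftmost-unique J-left (sort-factors g)) sub)
          in p f , q f , p g , q g , (p∈ f , q-min f , ⌞ pq≋v f ⌟) , (p∈ g , q-min g , ⌞ pq≋v g ⌟) , mo , le

    sorted-snoc : Sorted (s ∷ K) (ω ++ t)
    sorted-snoc = record
      { letters   = All.++⁺ (All.map there (letters sorted)) (∈W-letters t t∈ t-reduced)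
      ; ω-reduced = trans (List.length-++ ω) (trans (cong₂ ℕ._+_ (ω-reduced sorted) t-reduced) (sym (ℓ-++ ω t ω∈ t-shortest)))
      ; longest   = λ v v∈ →
          let f = factorize v v∈
          in subst₂ ℕ._≤_ (trans (sym (ℓ-++ (p f) (q f) (p∈ f) (minRep⇒shortest (q f) (q-min f)))) (ℓ-cong (pq≋v f)))
            (sym (ℓ-++ ω t ω∈ t-shortest))
            (ℕ.+-mono-≤ (longest sorted (p f) (p∈ f)) (proj₂ top (q f) (q-min f)))
      ; sort      = λ v v∈ → append ω t (sort₁ (factorize v v∈)) (sort₂ (factorize v v∈)) , sort-factors (factorize v v∈)
      ; order     = order-step
      }

  topWord-sorted : ∀ {σ ω} → Unique σ → MinusculeSequence σ → TopWord σ ω → Sorted σ ω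
  topWord-sorted []             _                 []                    = sorted-[]
  topWord-sorted (s≢K ∷ unique) (minuscule , seq) (snoc topω t-red top) =
    sorted-snoc (λ s∈K → All.lookup s≢K s∈K refl) minuscule (topWord-sorted unique seq topω) t-red top

-- The first conjunct establishes that ω is a reduced word for the longest element, as the notion of
-- a sorting order presupposes.
proposition8p1 : ∀ {n : ℕ} (R : RootSystem n) → let open WeylGroup R in
    (σ : List (Fin n)) → σ ↭ allFin n → MinusculeSequence σ →
    (ω : List (Fin n)) → TopWord σ ω →
    (Reduced ω × Longest ω) ×
    (∀ v w → MiddleOrder σ v w ⇔ SortingOrder ω v w)
proposition8p1 {n} R σ σ↭ seq ω topω = (ω-reduced sorted , λ v → longest sorted v (all∈W v)) , λ v w → mk⇔ (to v w) (from v w)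
  where
  open WeylGroup R
  open Parabolic R
  open SortingOrders R
  open Sorted
  unique : Unique σ
  unique = Permutation.Unique-resp-↭ (setoid (Fin n)) (↭⇒↭ₛ (↭-sym σ↭)) (allFin⁺ n)
  sorted : Sorted σ ω
  sorted = topWord-sorted unique seq topω
  all∈W : ∀ v → v ∈W σ
  all∈W v = letters-∈W (All.universal (λ i → ∈-resp-↭ (↭-sym σ↭) (∈-allFin i)) v)
  to : ∀ v w → MiddleOrder σ v w → SortingOrder ω v w
  to v w mo =
    let I , I-left = sort sorted v (all∈W v)
        J , J-left = sort sorted w (all∈W w)
    in I , J , leftmost-isSort I-left , leftmost-isSort J-left
     , Equivalence.to (order sorted v w (all∈W v) (all∈W w) I-left J-left) mo
  from : ∀ v w → SortingOrder ω v w → MiddleOrder σ v w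
  from v w (I , J , I-sort , J-sort , sub) =
    let I′ , I′-left = sort sorted v (all∈W v)
        J′ , J′-left = sort sorted w (all∈W w)
    in Equivalence.from (order sorted v w (all∈W v) (all∈W w) I′-left J′-left)
      (subst₂ _⊆_ (isSort-unique {ω} {v} I-sort (leftmost-isSort I′-left)) (isSort-unique {ω} {w} J-sort (leftmost-isSort J′-left)) sub)
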